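{- Let $\ell$ be a prime number. If $\mathcal A$ is a $1$-defect $\ell$-oddtown in $[n]$, then $|\mathcal A|\le\max\{n,2n-4\}$. Moreover, there exist $1$-defect $\ell$-oddtowns in $[n]$ of size $2n-4$ for infinitely many values of $n$.
   Context: A family $\mathcal A=\{A_1,\ldots,A_m\}$ of distinct subsets of $[n]$ is a $d$-defect $\ell$-oddtown if for every $i\in[m]$ we have $|A_i|\not\equiv 0 \pmod \ell$ and there are at most $d$ indices $j\in[m]\setminus\{i\}$ with $|A_i\cap A_j|\not\equiv 0\pmod\ell$. -}

module Defs where

open import Data.Nat using (ℕ; _≤_; NonZero)
open import Data.Nat.DivMod using (_%_)
open import Data.Fin using (Fin)
open import Data.Fin.Subset using (Subset; ∣_∣; _∩_)
open import Data.List using (List; length; filter)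
open import Data.List.Base using (allFin)
open import Data.Product using (_×_)
open import Function.Definitions using (Injective)
open import Relation.Binary.PropositionalEquality using (_≡_; _≢_)
open import Relation.Nullary using (¬_; _×-dec_; ¬?)
open import Relation.Nullary.Decidable using (Dec)
import Data.Nat as ℕ
import Data.Fin as F

Family : ℕ → ℕ → Set
Family m n = Fin m → Subset n

NotDiv : (ℓ : ℕ) .{{_ : NonZero ℓ}} → ℕ → Set
NotDiv ℓ x = ¬ (x % ℓ ≡ 0)

badPartners : ∀ {m n} (ℓ : ℕ) .{{_ : NonZero ℓ}} → Family m n → Fin m → List (Fin m)
badPartners ℓ A i =
  filter (λ j → ¬? (j F.≟ i) ×-dec ¬? (∣ A i ∩ A j ∣ % ℓ ℕ.≟ 0)) (allFin _)

IsDefectOddtown : ∀ {m n} (d ℓ : ℕ) .{{_ : NonZero ℓ}} → Family m n → Set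
IsDefectOddtown d ℓ A =
  Injective _≡_ _≡_ A
  × (∀ i → NotDiv ℓ ∣ A i ∣)
  × (∀ i → length (badPartners ℓ A i) ≤ d)

{-# OPTIONS --safe #-}

-- Work over ℤ modulo ℓ with the indicator vectors of the sets. Their Gram matrix is block
-- diagonal with blocks of size at most 2. If all blocks are nonsingular the vectors are
-- independent, so m ≤ n. A singular block of a pair A, B yields an isotropic vector
-- w = cA - aB ≠ 0 orthogonal to the whole family; the members chosen one from each block are
-- then orthogonal and anisotropic, and with w there is room for at most n - 2 of them.
--
-- For ℓ = 2 the bound is attained by the sets {i} and {1, 2, i}. For odd ℓ take a sign matrix
-- of order N ≡ -4 with rows pairwise orthogonal mod ℓ and first row constant: the sets
-- {∞} ∪ {x = 1} and {∞} ∪ {x = -1}, for the other rows x, form a family of size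
-- 2(N - 1) = 2n - 4 on n = N + 1 points. Such a matrix of order N = rv comes from an orthogonal
-- design of order r = 2^k with two variables of weights r - w and w, w = ℓ - 1, by substituting
-- for the variables the v × v matrices J and J - 2I, where rv ≡ 4w.
module Submission where

open import Defs
open import Data.Bool.Base using (Bool; true; false)
import Data.Bool.Properties as Bool
open import Data.Fin.Base as Fin using (Fin; zero; suc; toℕ; fromℕ<; _↑ˡ_; _↑ʳ_; funToFin; finToFun)
import Data.Fin.Properties as Fin
open import Data.Fin.Subset using (Subset; _∩_; ⁅_⁆; inside; outside) renaming (∣_∣ to card)
import Data.Fin.Subset.Properties as Subset
open import Data.Integer.Base as ℤ using (ℤ; +_; -_; ∣_∣; 0ℤ; 1ℤ; -1ℤ) renaming (_+_ to _⊕_; _-_ to _⊖_; _*_ to _⊗_)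
open import Data.Integer.DivMod using (_%ℕ_; _/ℕ_; n%ℕd<d; a≡a%ℕn+[a/ℕn]*n)
open import Data.Integer.Divisibility.Signed
import Data.Integer.Properties as ℤ
open import Data.Integer.Tactic.RingSolver using (solve-∀)
open import Data.List.Base using (List; []; _∷_; length; allFin)
open import Data.List.Membership.Propositional using (_∈_)
open import Data.List.Membership.Propositional.Properties using (∈-filter⁺; ∈-filter⁻; ∈-allFin)
open import Data.List.Relation.Unary.All using (_∷_)
open import Data.List.Relation.Unary.AllPairs using (_∷_)
open import Data.List.Relation.Unary.Any using (here; there)
open import Data.List.Relation.Unary.Unique.Propositional using (Unique)
open import Data.List.Relation.Unary.Unique.Propositional.Properties using (filter⁺; allFin⁺)
open import Data.Nat using (ℕ; zero; suc; _+_; _≤_; _<_; _∸_; _*_; _^_; _⊔_)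
import Data.Nat as ℕ
import Data.Nat.Divisibility as ℕ∣
open import Data.Nat.DivMod using (_%_)
open import Data.Nat.Primality using (Prime; prime⇒nonZero; prime⇒nonTrivial; prime⇒irreducible; euclidsLemma)
import Data.Nat.Properties as ℕ
open import Data.Product using (Σ; _×_; _,_; proj₁; proj₂; ∃; ∃-syntax)
open import Data.Sum using (_⊎_; inj₁; inj₂; [_,_]′)
open import Data.Vec.Base using ([]; _∷_; lookup; tabulate)
open import Data.Vec.Functional using (Vector; _++_; removeAt)
open import Data.Vec.Functional.Properties using (lookup-++ˡ; lookup-++ʳ)
open import Data.Vec.Properties using (tabulate∘lookup; lookup∘tabulate; tabulate-cong)
open import Function using (_∘_)
open import Relation.Binary.Definitions using (tri<; tri≈; tri>)
open import Relation.Binary.PropositionalEquality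
open import Relation.Nullary using (¬_; Dec; yes; no; contradiction; does; _×-dec_; ¬?)
open import Relation.Nullary.Decidable using (decidable-stable)
open import Algebra.Properties.Semiring.Sum ℤ.+-*-semiring
  using (sum; sum-cong-≗; sum-remove; ∑-distrib-+; ∑-comm; *-distribˡ-sum; *-distribʳ-sum; sum-replicate-zero)

private
  variable
    k m n r : ℕ

-- Dot products and the dimension bound modulo ℓ

-- Opaque, so that goals keep `dot x y` as an atom, which ring identities treat as a single
-- variable; the sum is exposed only through `dot≡sum`.
opaque
  dot : Vector ℤ n → Vector ℤ n → ℤ
  dot x y = sum (λ j → x j ⊗ y j)

  dot≡sum : (x y : Vector ℤ n) → dot x y ≡ sum (λ j → x j ⊗ y j)
  dot≡sum x y = refl

dot-cong : {x x′ y y′ : Vector ℤ n} → x ≗ x′ → y ≗ y′ → dot x y ≡ dot x′ y′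
dot-cong {x = x} {x′} {y} {y′} p q = begin
  dot x y                   ≡⟨ dot≡sum x y ⟩
  sum (λ j → x j ⊗ y j)     ≡⟨ sum-cong-≗ (λ j → cong₂ _⊗_ (p j) (q j)) ⟩
  sum (λ j → x′ j ⊗ y′ j)   ≡⟨ dot≡sum x′ y′ ⟨
  dot x′ y′                 ∎
  where open ≡-Reasoning

dot-comm : (x y : Vector ℤ n) → dot x y ≡ dot y x
dot-comm x y = begin
  dot x y                 ≡⟨ dot≡sum x y ⟩
  sum (λ j → x j ⊗ y j)   ≡⟨ sum-cong-≗ (λ j → ℤ.*-comm (x j) (y j)) ⟩
  sum (λ j → y j ⊗ x j)   ≡⟨ dot≡sum y x ⟨
  dot y x                 ∎
  where open ≡-Reasoning

lincomb : ℤ → Vector ℤ n → ℤ → Vector ℤ n → Vector ℤ n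
lincomb a x b y j = a ⊗ x j ⊕ b ⊗ y j

dot-lincombˡ : ∀ a (x : Vector ℤ n) b y z → dot (lincomb a x b y) z ≡ a ⊗ dot x z ⊕ b ⊗ dot y z
dot-lincombˡ a x b y z = begin
  dot (lincomb a x b y) z
    ≡⟨ dot≡sum (lincomb a x b y) z ⟩
  sum (λ j → (a ⊗ x j ⊕ b ⊗ y j) ⊗ z j)
    ≡⟨ sum-cong-≗ (λ j → distrib a (x j) b (y j) (z j)) ⟩
  sum (λ j → a ⊗ (x j ⊗ z j) ⊕ b ⊗ (y j ⊗ z j))
    ≡⟨ ∑-distrib-+ (λ j → a ⊗ (x j ⊗ z j)) (λ j → b ⊗ (y j ⊗ z j)) ⟩
  sum (λ j → a ⊗ (x j ⊗ z j)) ⊕ sum (λ j → b ⊗ (y j ⊗ z j))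
    ≡⟨ cong₂ _⊕_ (*-distribˡ-sum a (λ j → x j ⊗ z j)) (*-distribˡ-sum b (λ j → y j ⊗ z j)) ⟨
  a ⊗ sum (λ j → x j ⊗ z j) ⊕ b ⊗ sum (λ j → y j ⊗ z j)
    ≡⟨ cong₂ (λ s t → a ⊗ s ⊕ b ⊗ t) (dot≡sum x z) (dot≡sum y z) ⟨
  a ⊗ dot x z ⊕ b ⊗ dot y z ∎
  where
  open ≡-Reasoning
  distrib : ∀ a x b y z → (a ⊗ x ⊕ b ⊗ y) ⊗ z ≡ a ⊗ (x ⊗ z) ⊕ b ⊗ (y ⊗ z)
  distrib = solve-∀

dot-lincombʳ : ∀ a (x : Vector ℤ n) b y z → dot z (lincomb a x b y) ≡ a ⊗ dot z x ⊕ b ⊗ dot z y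
dot-lincombʳ a x b y z = begin
  dot z (lincomb a x b y)     ≡⟨ dot-comm z (lincomb a x b y) ⟩
  dot (lincomb a x b y) z     ≡⟨ dot-lincombˡ a x b y z ⟩
  a ⊗ dot x z ⊕ b ⊗ dot y z   ≡⟨ cong₂ (λ s t → a ⊗ s ⊕ b ⊗ t) (dot-comm x z) (dot-comm y z) ⟩
  a ⊗ dot z x ⊕ b ⊗ dot z y   ∎
  where open ≡-Reasoning

sum-splitAt : ∀ m (f : Vector ℤ (m + n)) → sum f ≡ sum (f ∘ (_↑ˡ n)) ⊕ sum (f ∘ (m ↑ʳ_))
sum-splitAt zero    f = sym (ℤ.+-identityˡ (sum f))
sum-splitAt (suc m) f =
  trans (cong (f zero ⊕_) (sum-splitAt m (f ∘ suc))) (sym (ℤ.+-assoc (f zero) _ _))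

dot-++ : (x y : Vector ℤ m) (x′ y′ : Vector ℤ n) → dot (x ++ x′) (y ++ y′) ≡ dot x y ⊕ dot x′ y′
dot-++ {m} {n} x y x′ y′ = begin
  dot (x ++ x′) (y ++ y′)
    ≡⟨ dot≡sum (x ++ x′) (y ++ y′) ⟩
  sum (λ j → (x ++ x′) j ⊗ (y ++ y′) j)
    ≡⟨ sum-splitAt m (λ j → (x ++ x′) j ⊗ (y ++ y′) j) ⟩
  sum (λ j → (x ++ x′) (j ↑ˡ n) ⊗ (y ++ y′) (j ↑ˡ n)) ⊕ sum (λ j → (x ++ x′) (m ↑ʳ j) ⊗ (y ++ y′) (m ↑ʳ j))
    ≡⟨ cong₂ _⊕_ (dot≡sum ((x ++ x′) ∘ (_↑ˡ n)) ((y ++ y′) ∘ (_↑ˡ n))) (dot≡sum ((x ++ x′) ∘ (m ↑ʳ_)) ((y ++ y′) ∘ (m ↑ʳ_))) ⟨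
  dot ((x ++ x′) ∘ (_↑ˡ n)) ((y ++ y′) ∘ (_↑ˡ n)) ⊕ dot ((x ++ x′) ∘ (m ↑ʳ_)) ((y ++ y′) ∘ (m ↑ʳ_))
    ≡⟨ cong₂ _⊕_ (dot-cong (lookup-++ˡ x x′) (lookup-++ˡ y y′)) (dot-cong (lookup-++ʳ x x′) (lookup-++ʳ y y′)) ⟩
  dot x y ⊕ dot x′ y′ ∎
  where open ≡-Reasoning

𝟘 : Vector ℤ n
𝟘 _ = 0ℤ

dot-zeroˡ : (y : Vector ℤ n) → dot 𝟘 y ≡ 0ℤ
dot-zeroˡ {n} y = trans (dot≡sum 𝟘 y) (trans (sum-cong-≗ (λ j → ℤ.*-zeroˡ (y j))) (sum-replicate-zero n))

dot-zeroʳ : (y : Vector ℤ n) → dot y 𝟘 ≡ 0ℤ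
dot-zeroʳ y = trans (dot-comm y 𝟘) (dot-zeroˡ y)

dot-removeAt : (x y : Vector ℤ (suc n)) (j : Fin (suc n)) →
               dot x y ≡ x j ⊗ y j ⊕ dot (removeAt x j) (removeAt y j)
dot-removeAt x y j = begin
  dot x y                                                   ≡⟨ dot≡sum x y ⟩
  sum (λ i → x i ⊗ y i)                                     ≡⟨ sum-remove {i = j} (λ i → x i ⊗ y i) ⟩
  x j ⊗ y j ⊕ sum (λ i → removeAt x j i ⊗ removeAt y j i)   ≡⟨ cong (x j ⊗ y j ⊕_) (dot≡sum (removeAt x j) (removeAt y j)) ⟨
  x j ⊗ y j ⊕ dot (removeAt x j) (removeAt y j)             ∎
  where open ≡-Reasoning

module Modular (ℓ : ℕ) (pr : Prime ℓ) where

  instance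
    ℓ-nonZero : ℕ.NonZero ℓ
    ℓ-nonZero = prime⇒nonZero pr

  1<ℓ : 1 < ℓ
  1<ℓ = ℕ.nonTrivial⇒n>1 ℓ {{prime⇒nonTrivial pr}}

  infix 4 ℓ∣_
  ℓ∣_ : ℤ → Set
  ℓ∣ x = + ℓ ∣ x

  ℓ∣0 : ℓ∣ 0ℤ
  ℓ∣0 = divides 0ℤ refl

  ℓ∣-* : ∀ x y → ℓ∣ x ⊗ y → ℓ∣ x ⊎ ℓ∣ y
  ℓ∣-* x y ℓ∣xy with euclidsLemma ∣ x ∣ ∣ y ∣ pr (subst (ℓ ℕ∣.∣_) (ℤ.abs-* x y) (∣⇒∣ᵤ ℓ∣xy))
  ... | inj₁ p = inj₁ (∣ᵤ⇒∣ p)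
  ... | inj₂ p = inj₂ (∣ᵤ⇒∣ p)

  ℓ∤-* : ∀ x y → ¬ ℓ∣ x → ¬ ℓ∣ y → ¬ ℓ∣ x ⊗ y
  ℓ∤-* x y ℓ∤x ℓ∤y ℓ∣xy = [ ℓ∤x , ℓ∤y ]′ (ℓ∣-* x y ℓ∣xy)

  ℓ∣-sum : (f : Vector ℤ n) → (∀ i → ℓ∣ f i) → ℓ∣ sum f
  ℓ∣-sum {zero}  f ℓ∣f = ℓ∣0
  ℓ∣-sum {suc n} f ℓ∣f = ∣m∣n⇒∣m+n (ℓ∣f zero) (ℓ∣-sum (f ∘ suc) (ℓ∣f ∘ suc))

  ℓ∣-sum-single : (f : Vector ℤ n) (i : Fin n) → (∀ j → j ≢ i → ℓ∣ f j) → ℓ∣ sum f → ℓ∣ f i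
  ℓ∣-sum-single {suc n} f i ℓ∣f ℓ∣Σ =
    ∣m+n∣n⇒∣m (subst ℓ∣_ (sum-remove {i = i} f) ℓ∣Σ)
              (ℓ∣-sum (removeAt f i) (λ j → ℓ∣f (Fin.punchIn i j) (Fin.punchInᵢ≢i i j)))

  -- The difference has absolute value below `ℓ`, so a multiple of `ℓ` can only be zero.
  toℕ-injective-mod : (a b : Fin ℓ) → ℓ∣ + toℕ a ⊖ + toℕ b → a ≡ b
  toℕ-injective-mod a b ℓ∣a-b = Fin.toℕ-injective (ℤ.+-injective (ℤ.i-j≡0⇒i≡j _ _ (ℤ.∣i∣≡0⇒i≡0 ∣a-b∣≡0)))
    where
    ∣a-b∣<ℓ : ∣ + toℕ a ⊖ + toℕ b ∣ < ℓ
    ∣a-b∣<ℓ = ℕ.≤-<-trans (ℕ.≤-trans (ℕ.≤-reflexive (cong ∣_∣ (ℤ.m-n≡m⊖n (toℕ a) (toℕ b)))) (ℤ.∣m⊝n∣≤m⊔n (toℕ a) (toℕ b)))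
                          (ℕ.⊔-pres-<m (Fin.toℕ<n a) (Fin.toℕ<n b))
    ∣a-b∣≡0 : ∣ + toℕ a ⊖ + toℕ b ∣ ≡ 0
    ∣a-b∣≡0 with ∣ + toℕ a ⊖ + toℕ b ∣ in eq
    ... | zero  = refl
    ... | suc d = contradiction (subst (ℓ ℕ∣.∣_) eq (∣⇒∣ᵤ ℓ∣a-b))
                    (ℕ∣.>⇒∤ (subst (_< ℓ) eq ∣a-b∣<ℓ))

  residue : ℤ → Fin ℓ
  residue x = fromℕ< (n%ℕd<d x ℓ)

  residue-≡⇒∣ : ∀ x y → residue x ≡ residue y → ℓ∣ x ⊖ y
  residue-≡⇒∣ x y eq = divides (x /ℕ ℓ ⊖ y /ℕ ℓ) (begin
    x ⊖ y                                                          ≡⟨ cong₂ _⊖_ (a≡a%ℕn+[a/ℕn]*n x ℓ) (a≡a%ℕn+[a/ℕn]*n y ℓ) ⟩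
    (+ (x %ℕ ℓ) ⊕ x /ℕ ℓ ⊗ + ℓ) ⊖ (+ (y %ℕ ℓ) ⊕ y /ℕ ℓ ⊗ + ℓ)      ≡⟨ cong (λ r → (+ r ⊕ x /ℕ ℓ ⊗ + ℓ) ⊖ (+ (y %ℕ ℓ) ⊕ y /ℕ ℓ ⊗ + ℓ)) %-eq ⟩
    (+ (y %ℕ ℓ) ⊕ x /ℕ ℓ ⊗ + ℓ) ⊖ (+ (y %ℕ ℓ) ⊕ y /ℕ ℓ ⊗ + ℓ)      ≡⟨ collect (+ (y %ℕ ℓ)) (x /ℕ ℓ) (y /ℕ ℓ) (+ ℓ) ⟩
    (x /ℕ ℓ ⊖ y /ℕ ℓ) ⊗ + ℓ                                        ∎)
    where
    open ≡-Reasoning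
    %-eq : x %ℕ ℓ ≡ y %ℕ ℓ
    %-eq = trans (sym (Fin.toℕ-fromℕ< (n%ℕd<d x ℓ))) (trans (cong toℕ eq) (Fin.toℕ-fromℕ< (n%ℕd<d y ℓ)))
    collect : ∀ r a b l → (r ⊕ a ⊗ l) ⊖ (r ⊕ b ⊗ l) ≡ (a ⊖ b) ⊗ l
    collect = solve-∀

  -- There are ℓ ^ k coefficient vectors mod ℓ but only ℓ ^ n values of the combination,
  -- so two of them collide; their difference is the relation.
  linear-relation : n < k → (v : Fin k → Vector ℤ n) →
    ∃[ c ] (∃[ i ] ¬ ℓ∣ c i) × (∀ j → ℓ∣ dot c (λ i → v i j))
  linear-relation {n} {k} n<k v with Fin.pigeonhole (ℕ.^-monoʳ-< ℓ 1<ℓ n<k) value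
    where
    coeff : Fin (ℓ ^ k) → Vector ℤ k
    coeff a i = + toℕ (finToFun a i)
    value : Fin (ℓ ^ k) → Fin (ℓ ^ n)
    value a = funToFin (λ j → residue (dot (coeff a) (λ i → v i j)))
  ... | a , b , a<b , eq = c , nontrivial , vanishing
    where
    α = finToFun {ℓ} {k} a
    β = finToFun {ℓ} {k} b
    c : Vector ℤ k
    c i = + toℕ (α i) ⊖ + toℕ (β i)
    funToFin-cong : ∀ {p q} {f g : Fin p → Fin q} → f ≗ g → funToFin f ≡ funToFin g
    funToFin-cong {zero}  f≗g = refl
    funToFin-cong {suc p} f≗g = cong₂ Fin.combine (f≗g zero) (funToFin-cong (f≗g ∘ suc))
    nontrivial : ∃[ i ] ¬ ℓ∣ c i
    -- If every difference were divisible by `ℓ`, the two coefficient vectors would agree digit by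
    -- digit, against `a<b`.
    nontrivial = Fin.¬∀⟶∃¬ k (λ i → ℓ∣ c i) (λ i → + ℓ ∣? c i) λ ℓ∣c → Fin.<⇒≢ a<b
      (trans (sym (Fin.funToFin-finToFin {k} {ℓ} a))
      (trans (funToFin-cong (λ i → toℕ-injective-mod (α i) (β i) (ℓ∣c i)))
             (Fin.funToFin-finToFin {k} {ℓ} b)))
    vanishing : ∀ j → ℓ∣ dot c (λ i → v i j)
    vanishing j = subst ℓ∣_ (begin
      dot a′ vⱼ ⊖ dot b′ vⱼ                ≡⟨ minus (dot a′ vⱼ) (dot b′ vⱼ) ⟨
      1ℤ ⊗ dot a′ vⱼ ⊕ -1ℤ ⊗ dot b′ vⱼ     ≡⟨ dot-lincombˡ 1ℤ a′ -1ℤ b′ vⱼ ⟨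
      dot (lincomb 1ℤ a′ -1ℤ b′) vⱼ        ≡⟨ dot-cong (λ i → minus (a′ i) (b′ i)) (λ _ → refl) ⟩
      dot c vⱼ                             ∎)
      (residue-≡⇒∣ (dot a′ vⱼ) (dot b′ vⱼ)
        (trans (sym (Fin.finToFun-funToFin _ j)) (trans (cong (λ z → finToFun z j) eq) (Fin.finToFun-funToFin _ j))))
      where
      open ≡-Reasoning
      a′ b′ vⱼ : Vector ℤ k
      a′ i = + toℕ (α i)
      b′ i = + toℕ (β i)
      vⱼ i = v i j
      minus : ∀ x y → 1ℤ ⊗ x ⊕ -1ℤ ⊗ y ≡ x ⊖ y
      minus = solve-∀

  -- If k > n there is a nontrivial relation modulo `ℓ` among the `v i`. Pairing it with `u i`,
  -- where `c i` is a unit, leaves only `c i ⊗ dot (v i) (u i)`, which is not divisible by `ℓ`.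
  biorthogonal⇒≤ : (v u : Fin k → Vector ℤ n) →
    (∀ i → ¬ ℓ∣ dot (v i) (u i)) → (∀ i j → i ≢ j → ℓ∣ dot (v i) (u j)) → k ≤ n
  biorthogonal⇒≤ {k} {n} v u diag off with k ℕ.≤? n
  ... | yes k≤n = k≤n
  ... | no  k≰n with linear-relation (ℕ.≰⇒> k≰n) v
  ...   | c , (i , ℓ∤cᵢ) , rel = contradiction
    (ℓ∣-sum-single (λ i′ → c i′ ⊗ dot (v i′) (u i)) i
      (λ j j≢i → ∣n⇒∣m*n (c j) (off j i j≢i))
      (subst ℓ∣_ swap (ℓ∣-sum (λ j → dot c (λ i′ → v i′ j) ⊗ u i j) (λ j → ∣m⇒∣m*n (u i j) (rel j)))))
    (ℓ∤-* (c i) _ ℓ∤cᵢ (diag i))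
    where
    open ≡-Reasoning
    swap : sum (λ j → dot c (λ i′ → v i′ j) ⊗ u i j) ≡ sum (λ i′ → c i′ ⊗ dot (v i′) (u i))
    swap = begin
      sum (λ j → dot c (λ i′ → v i′ j) ⊗ u i j)
        ≡⟨ sum-cong-≗ (λ j → cong (_⊗ u i j) (dot≡sum c (λ i′ → v i′ j))) ⟩
      sum (λ j → sum (λ i′ → c i′ ⊗ v i′ j) ⊗ u i j)
        ≡⟨ sum-cong-≗ (λ j → *-distribʳ-sum (u i j) (λ i′ → c i′ ⊗ v i′ j)) ⟩
      sum (λ j → sum (λ i′ → c i′ ⊗ v i′ j ⊗ u i j))
        ≡⟨ ∑-comm (λ j i′ → c i′ ⊗ v i′ j ⊗ u i j) ⟩
      sum (λ i′ → sum (λ j → c i′ ⊗ v i′ j ⊗ u i j))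
        ≡⟨ sum-cong-≗ (λ i′ → trans (sum-cong-≗ (λ j → ℤ.*-assoc (c i′) (v i′ j) (u i j)))
                             (trans (sym (*-distribˡ-sum (c i′) (λ j → v i′ j ⊗ u i j)))
                                    (cong (c i′ ⊗_) (sym (dot≡sum (v i′) (u i)))))) ⟩
      sum (λ i′ → c i′ ⊗ dot (v i′) (u i)) ∎

  -- Placed in the two halves of ℤ²ⁿ according to its colour, the whole family is orthogonal.
  two-coloured⇒≤ : (colour : Fin k → Bool) (v : Fin k → Vector ℤ n) →
    (∀ i → ¬ ℓ∣ dot (v i) (v i)) →
    (∀ i j → i ≢ j → colour i ≡ colour j → ℓ∣ dot (v i) (v j)) → k ≤ n + n
  two-coloured⇒≤ {k} {n} colour v diag off =
    biorthogonal⇒≤ v′ v′ (λ i → diag i ∘ subst ℓ∣_ (same (colour i) (v i) (v i))) off′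
    where
    place : Bool → Vector ℤ n → Vector ℤ (n + n)
    place true  x = x ++ 𝟘
    place false x = 𝟘 ++ x
    v′ : Fin k → Vector ℤ (n + n)
    v′ i = place (colour i) (v i)
    same : ∀ b x y → dot (place b x) (place b y) ≡ dot x y
    same true  x y = trans (dot-++ x y 𝟘 𝟘) (trans (cong (dot x y ⊕_) (dot-zeroˡ 𝟘)) (ℤ.+-identityʳ (dot x y)))
    same false x y = trans (dot-++ 𝟘 𝟘 x y) (trans (cong (_⊕ dot x y) (dot-zeroˡ 𝟘)) (ℤ.+-identityˡ (dot x y)))
    off′ : ∀ i j → i ≢ j → ℓ∣ dot (v′ i) (v′ j)
    off′ i j i≢j with colour i in ci | colour j in cj
    ... | true  | true  = subst ℓ∣_ (sym (same true (v i) (v j))) (off i j i≢j (trans ci (sym cj)))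
    ... | false | false = subst ℓ∣_ (sym (same false (v i) (v j))) (off i j i≢j (trans ci (sym cj)))
    ... | true  | false = subst ℓ∣_ (sym (trans (dot-++ (v i) 𝟘 𝟘 (v j)) (cong₂ _⊕_ (dot-zeroʳ (v i)) (dot-zeroˡ (v j))))) ℓ∣0
    ... | false | true  = subst ℓ∣_ (sym (trans (dot-++ 𝟘 (v j) (v i) 𝟘) (cong₂ _⊕_ (dot-zeroˡ (v j)) (dot-zeroʳ (v i))))) ℓ∣0

-- The upper bound for vectors whose Gram matrix has blocks of size at most 2

module UpperBound (ℓ : ℕ) (pr : Prime ℓ) where
  open Modular ℓ pr

  -- Subtracting multiples of w moves the family into the hyperplane where coordinate t vanishes.
  -- There w, truncated, has norm - (w t)², so it can be added to both colour classes.
  two-coloured-with-radical⇒≤ : ∀ {m n} (v : Fin m → Vector ℤ n) (colour : Fin m → Bool) →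
    (∀ i → ¬ ℓ∣ dot (v i) (v i)) →
    (∀ i j → i ≢ j → colour i ≡ colour j → ℓ∣ dot (v i) (v j)) →
    (w : Vector ℤ n) (t : Fin n) → ¬ ℓ∣ w t → ℓ∣ dot w w → (∀ i → ℓ∣ dot w (v i)) →
    4 + m ≤ n + n
  two-coloured-with-radical⇒≤ {m} {suc n} v colour diagonal off w t ℓ∤wt w⊥w w⊥v =
    -- The `m` vectors and two copies of `w` live in dimension `n` after truncation, so 2 + m ≤ 2n.
    -- The ambient dimension is n + 1, which supplies the other 2.
    ℕ.≤-trans (ℕ.+-monoʳ-≤ 2 (two-coloured⇒≤ colour′ (λ i → removeAt (u i) t) diagonal′ off′))
              (ℕ.≤-reflexive (cong suc (sym (ℕ.+-suc n n))))
    where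
    v′ : Fin m → Vector ℤ (suc n)
    v′ i = lincomb (w t) (v i) (- v i t) w

    w⊥v′ : ∀ i → ℓ∣ dot w (v′ i)
    w⊥v′ i = subst ℓ∣_ (sym (dot-lincombʳ (w t) (v i) (- v i t) w w))
      (∣m∣n⇒∣m+n (∣n⇒∣m*n (w t) (w⊥v i)) (∣n⇒∣m*n (- v i t) w⊥w))

    -- The part of the expanded Gram entry in which every term contains a product with `w`; it
    -- vanishes modulo `ℓ`.
    error : Fin m → Fin m → ℤ
    error i j = w t ⊗ (- v j t ⊗ dot (v i) w) ⊕ - v i t ⊗ dot w (v′ j)

    ℓ∣error : ∀ i j → ℓ∣ error i j
    ℓ∣error i j = ∣m∣n⇒∣m+n
      (∣n⇒∣m*n (w t) (∣n⇒∣m*n (- v j t) (subst ℓ∣_ (dot-comm w (v i)) (w⊥v i))))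
      (∣n⇒∣m*n (- v i t) (w⊥v′ j))

    v′-gram : ∀ i j → dot (v′ i) (v′ j) ≡ w t ⊗ w t ⊗ dot (v i) (v j) ⊕ error i j
    v′-gram i j = begin
      dot (v′ i) (v′ j)
        ≡⟨ dot-lincombˡ (w t) (v i) (- v i t) w (v′ j) ⟩
      w t ⊗ dot (v i) (v′ j) ⊕ - v i t ⊗ dot w (v′ j)
        ≡⟨ cong (λ z → w t ⊗ z ⊕ - v i t ⊗ dot w (v′ j)) (dot-lincombʳ (w t) (v j) (- v j t) w (v i)) ⟩
      w t ⊗ (w t ⊗ dot (v i) (v j) ⊕ - v j t ⊗ dot (v i) w) ⊕ - v i t ⊗ dot w (v′ j)
        ≡⟨ rearrange (w t) (dot (v i) (v j)) (- v j t ⊗ dot (v i) w) (- v i t ⊗ dot w (v′ j)) ⟩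
      w t ⊗ w t ⊗ dot (v i) (v j) ⊕ error i j ∎
      where
      open ≡-Reasoning
      rearrange : ∀ a g x y → a ⊗ (a ⊗ g ⊕ x) ⊕ y ≡ a ⊗ a ⊗ g ⊕ (a ⊗ x ⊕ y)
      rearrange = solve-∀

    v′t≡0 : ∀ i → v′ i t ≡ 0ℤ
    v′t≡0 i = cancel (w t) (v i t)
      where
      cancel : ∀ a b → a ⊗ b ⊕ - b ⊗ a ≡ 0ℤ
      cancel = solve-∀

    restrict : ∀ i x → dot x (v′ i) ≡ dot (removeAt x t) (removeAt (v′ i) t)
    restrict i x = begin
      dot x (v′ i)          ≡⟨ dot-removeAt x (v′ i) t ⟩
      x t ⊗ v′ i t ⊕ rest   ≡⟨ cong (λ z → x t ⊗ z ⊕ rest) (v′t≡0 i) ⟩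
      x t ⊗ 0ℤ ⊕ rest       ≡⟨ cong (_⊕ rest) (ℤ.*-zeroʳ (x t)) ⟩
      0ℤ ⊕ rest             ≡⟨ ℤ.+-identityˡ rest ⟩
      rest                  ∎
      where
      open ≡-Reasoning
      rest = dot (removeAt x t) (removeAt (v′ i) t)

    w-truncated : ¬ ℓ∣ dot (removeAt w t) (removeAt w t)
    w-truncated ℓ∣ww = ℓ∤-* (w t) (w t) ℓ∤wt ℓ∤wt (∣m+n∣n⇒∣m (subst ℓ∣_ (dot-removeAt w w t) w⊥w) ℓ∣ww)

    u : Fin (2 + m) → Vector ℤ (suc n)
    u zero          = w
    u (suc zero)    = w
    u (suc (suc i)) = v′ i

    colour′ : Fin (2 + m) → Bool
    colour′ zero          = true
    colour′ (suc zero)    = false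
    colour′ (suc (suc i)) = colour i

    diagonal′ : ∀ i → ¬ ℓ∣ dot (removeAt (u i) t) (removeAt (u i) t)
    diagonal′ zero          = w-truncated
    diagonal′ (suc zero)    = w-truncated
    diagonal′ (suc (suc i)) ℓ∣uu =
      ℓ∤-* (w t ⊗ w t) (dot (v i) (v i)) (ℓ∤-* (w t) (w t) ℓ∤wt ℓ∤wt) (diagonal i)
        (∣m+n∣n⇒∣m (subst ℓ∣_ (trans (sym (restrict i (v′ i))) (v′-gram i i)) ℓ∣uu) (ℓ∣error i i))

    w-off : ∀ i → ℓ∣ dot (removeAt w t) (removeAt (v′ i) t)
    w-off i = subst ℓ∣_ (restrict i w) (w⊥v′ i)

    off-w : ∀ i → ℓ∣ dot (removeAt (v′ i) t) (removeAt w t)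
    off-w i = subst ℓ∣_ (dot-comm (removeAt w t) (removeAt (v′ i) t)) (w-off i)

    off′ : ∀ i j → i ≢ j → colour′ i ≡ colour′ j → ℓ∣ dot (removeAt (u i) t) (removeAt (u j) t)
    off′ zero          zero          i≢j _ = contradiction refl i≢j
    off′ (suc zero)    (suc zero)    i≢j _ = contradiction refl i≢j
    off′ zero          (suc (suc j)) _   _ = w-off j
    off′ (suc zero)    (suc (suc j)) _   _ = w-off j
    off′ (suc (suc i)) zero          _   _ = off-w i
    off′ (suc (suc i)) (suc zero)    _   _ = off-w i
    off′ (suc (suc i)) (suc (suc j)) i≢j same =
      subst ℓ∣_ (trans (sym (v′-gram i j)) (restrict j (v′ i)))
        (∣m∣n⇒∣m+n (∣n⇒∣m*n (w t ⊗ w t) (off i j (λ i≡j → i≢j (cong (λ k → suc (suc k)) i≡j)) same)) (ℓ∣error i j))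

  -- The 1-defect condition in terms of vectors: `unique` allows each vector at most one
  -- non-orthogonal companion. `independent`, which indicators of distinct sets satisfy, guarantees
  -- that the isotropic vector of a singular block is nonzero modulo `ℓ`.
  module Matched {m n} (v : Fin m → Vector ℤ n)
    (diagonal : ∀ i → ¬ ℓ∣ dot (v i) (v i))
    (unique : ∀ {i j k} → j ≢ i → k ≢ i → ¬ ℓ∣ dot (v i) (v j) → ¬ ℓ∣ dot (v i) (v k) → j ≡ k)
    (independent : ∀ {i j} p q → i ≢ j → ¬ ℓ∣ p → ¬ ℓ∣ q → ∃[ t ] ¬ ℓ∣ lincomb p (v i) q (v j) t)
    where

    g : Fin m → Fin m → ℤ
    g i j = dot (v i) (v j)

    Matches : Fin m → Fin m → Set
    Matches i j = j ≢ i × ¬ ℓ∣ g i j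

    matches? : ∀ i j → Dec (Matches i j)
    matches? i j = ¬? (j Fin.≟ i) ×-dec ¬? (+ ℓ ∣? g i j)

    matches-sym : ∀ {i j} → Matches i j → Matches j i
    matches-sym {i} {j} (j≢i , ℓ∤g) = j≢i ∘ sym , ℓ∤g ∘ subst ℓ∣_ (dot-comm (v j) (v i))

    matches-unique : ∀ {i j k} → Matches i j → Matches i k → j ≡ k
    matches-unique (j≢i , p) (k≢i , q) = unique j≢i k≢i p q

    unmatched⇒∣ : ∀ {i j} → j ≢ i → ¬ Matches i j → ℓ∣ g i j
    unmatched⇒∣ {i} {j} j≢i ¬match = decidable-stable (+ ℓ ∣? g i j) (λ ℓ∤g → ¬match (j≢i , ℓ∤g))

    -- If `k` matched one of the two indices, symmetry and uniqueness would identify it with the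
    -- other.
    others⇒∣ : ∀ {i j k} → Matches i j → k ≢ i → k ≢ j → ℓ∣ g k i × ℓ∣ g k j
    others⇒∣ {i} {j} {k} i~j k≢i k≢j =
      unmatched⇒∣ (k≢i ∘ sym) (λ k~i → k≢j (matches-unique (matches-sym k~i) i~j)) ,
      unmatched⇒∣ (k≢j ∘ sym) (λ k~j → k≢i (matches-unique (matches-sym k~j) (matches-sym i~j)))

    -- The Gram determinant of a pair, in the shape in which it arises as the product of `v i` with
    -- its dual vector.
    det : Fin m → Fin m → ℤ
    det i j = g j j ⊗ g i i ⊕ - g i j ⊗ g i j

    -- An unmatched vector is its own dual. For a matched pair the combination
    -- `g j j ⊗ v i - g i j ⊗ v j` is orthogonal to `v j` and has product `det i j` with `v i`, so
    -- the family and its duals are biorthogonal.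
    nondegenerate⇒≤ : (∀ i j → Matches i j → ¬ ℓ∣ det i j) → m ≤ n
    nondegenerate⇒≤ nondeg = biorthogonal⇒≤ v (λ i → dual i (partner? i))
        (λ i → dual-diagonal i (partner? i)) (λ i j → dual-off j i (partner? j))
      where
      partner? : ∀ i → Dec (∃ (Matches i))
      partner? i = Fin.any? (matches? i)

      dual : ∀ i → Dec (∃ (Matches i)) → Vector ℤ n
      dual i (yes (j , _)) = lincomb (g j j) (v i) (- g i j) (v j)
      dual i (no _)        = v i

      dual-diagonal : ∀ i d → ¬ ℓ∣ dot (v i) (dual i d)
      dual-diagonal i (yes (j , i~j)) =
        nondeg i j i~j ∘ subst ℓ∣_ (dot-lincombʳ (g j j) (v i) (- g i j) (v j) (v i))
      dual-diagonal i (no _) = diagonal i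

      dual-off : ∀ i k d → k ≢ i → ℓ∣ dot (v k) (dual i d)
      dual-off i k (no unmatched) k≢i = unmatched⇒∣ (k≢i ∘ sym) (λ k~i → unmatched (k , matches-sym k~i))
      dual-off i k (yes (j , i~j)) k≢i =
        subst ℓ∣_ (sym (dot-lincombʳ (g j j) (v i) (- g i j) (v j) (v k))) (by-cases (k Fin.≟ j))
        where
        cancel : ∀ x y → x ⊗ y ⊕ - y ⊗ x ≡ 0ℤ
        cancel = solve-∀
        by-cases : Dec (k ≡ j) → ℓ∣ g j j ⊗ g k i ⊕ - g i j ⊗ g k j
        by-cases (yes refl) = subst ℓ∣_
          (sym (trans (cong (λ z → g j j ⊗ z ⊕ - g i j ⊗ g j j) (dot-comm (v j) (v i))) (cancel (g j j) (g i j)))) ℓ∣0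
        by-cases (no k≢j) =
          let ℓ∣gki , ℓ∣gkj = others⇒∣ i~j k≢i k≢j
          in ∣m∣n⇒∣m+n (∣n⇒∣m*n (g j j) ℓ∣gki) (∣n⇒∣m*n (- g i j) ℓ∣gkj)

    second-of-pair? : ∀ i → Dec (∃[ j ] j Fin.< i × Matches i j)
    second-of-pair? i = Fin.any? (λ j → j Fin.<? i ×-dec matches? i j)

    colour : Fin m → Bool
    colour i = does (second-of-pair? i)

    -- Of two matched indices only the larger one has a smaller partner, so a matched pair always
    -- receives both colours.
    same-colour⇒∣ : ∀ i k → i ≢ k → colour i ≡ colour k → ℓ∣ g i k
    same-colour⇒∣ i k i≢k ci≡ck with second-of-pair? i | second-of-pair? k
    ... | no ¬i | no ¬k = unmatched⇒∣ (i≢k ∘ sym) λ i~k → case-< i~k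
      where
      case-< : ¬ Matches i k
      case-< i~k with ℕ.<-cmp (toℕ i) (toℕ k)
      ... | tri< i<k _ _ = ¬k (i , i<k , matches-sym i~k)
      ... | tri≈ _ i≡k _ = i≢k (Fin.toℕ-injective i≡k)
      ... | tri> _ _ k<i = ¬i (k , k<i , i~k)
    ... | yes (i′ , i′<i , i~i′) | yes (k′ , k′<k , k~k′) = unmatched⇒∣ (i≢k ∘ sym) λ i~k →
      ℕ.<-asym (subst (λ z → toℕ z < toℕ i) (matches-unique i~i′ i~k) i′<i)
               (subst (λ z → toℕ z < toℕ k) (matches-unique k~k′ (matches-sym i~k)) k′<k)

    -- The vector `w` is orthogonal to `v α` identically, its product with `v β` is minus the
    -- determinant, and all other members are orthogonal to both. Hence `w` is also isotropic. Both
    -- of its coefficients are units modulo `ℓ`, so it has a coordinate not divisible by `ℓ`.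
    degenerate⇒≤ : ∀ {α β} → Matches α β → ℓ∣ det α β → 4 + m ≤ n + n
    degenerate⇒≤ {α} {β} α~β degen with independent (g α β) (- g α α) (proj₁ α~β ∘ sym) (proj₂ α~β) (diagonal α ∘ neg⁻¹)
      where
      neg⁻¹ : ∀ {x} → ℓ∣ - x → ℓ∣ x
      neg⁻¹ {x} ℓ∣-x = subst ℓ∣_ (ℤ.neg-involutive x) (∣m⇒∣-m ℓ∣-x)
    ... | t , ℓ∤wt = two-coloured-with-radical⇒≤ v colour diagonal same-colour⇒∣ w t ℓ∤wt w⊥w w⊥v
      where
      w : Vector ℤ n
      w = lincomb (g α β) (v α) (- g α α) (v β)

      w⊥v : ∀ i → ℓ∣ dot w (v i)
      w⊥v i = subst ℓ∣_ (sym (dot-lincombˡ (g α β) (v α) (- g α α) (v β) (v i))) (by-cases (i Fin.≟ α) (i Fin.≟ β))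
        where
        cancel : ∀ a c → c ⊗ a ⊕ - a ⊗ c ≡ 0ℤ
        cancel = solve-∀
        det-form : ∀ a b c → - (b ⊗ a ⊕ - c ⊗ c) ≡ c ⊗ c ⊕ - a ⊗ b
        det-form = solve-∀
        by-cases : Dec (i ≡ α) → Dec (i ≡ β) → ℓ∣ g α β ⊗ g α i ⊕ - g α α ⊗ g β i
        by-cases (yes refl) _ = subst ℓ∣_
          (sym (trans (cong (λ z → g α β ⊗ g α α ⊕ - g α α ⊗ z) (dot-comm (v β) (v α))) (cancel (g α α) (g α β)))) ℓ∣0
        by-cases (no _) (yes refl) = subst ℓ∣_ (det-form (g α α) (g β β) (g α β)) (∣m⇒∣-m degen)
        by-cases (no i≢α) (no i≢β) =
          let ℓ∣giα , ℓ∣giβ = others⇒∣ α~β i≢α i≢β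
          in ∣m∣n⇒∣m+n (∣n⇒∣m*n (g α β) (subst ℓ∣_ (dot-comm (v i) (v α)) ℓ∣giα))
                       (∣n⇒∣m*n (- g α α) (subst ℓ∣_ (dot-comm (v i) (v β)) ℓ∣giβ))

      w⊥w : ℓ∣ dot w w
      w⊥w = subst ℓ∣_ (sym (dot-lincombʳ (g α β) (v α) (- g α α) (v β) w))
        (∣m∣n⇒∣m+n (∣n⇒∣m*n (g α β) (w⊥v α)) (∣n⇒∣m*n (- g α α) (w⊥v β)))

    bound : m ≤ n ⊔ (2 * n ∸ 4)
    bound with Fin.any? (λ i → Fin.any? (λ j → matches? i j ×-dec (+ ℓ ∣? det i j)))
    ... | no ¬degen = ℕ.m≤n⇒m≤n⊔o (2 * n ∸ 4) (nondegenerate⇒≤ (λ i j i~j ℓ∣det → ¬degen (i , j , i~j , ℓ∣det)))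
    ... | yes (i , j , i~j , ℓ∣det) = ℕ.m≤n⇒m≤o⊔n n (ℕ.m+n≤o⇒m≤o∸n m
            (subst₂ _≤_ (ℕ.+-comm 4 m) (cong (n ℕ.+_) (sym (ℕ.+-identityʳ n))) (degenerate⇒≤ i~j ℓ∣det)))

-- Set families

bit : Bool → ℤ
bit true  = 1ℤ
bit false = 0ℤ

indicator : Subset n → Vector ℤ n
indicator p j = bit (lookup p j)

dot-indicator : (p q : Subset n) → dot (indicator p) (indicator q) ≡ + card (p ∩ q)
dot-indicator p q = trans (dot≡sum (indicator p) (indicator q)) (sum-indicator p q)
  where
  sum-indicator : ∀ {n} (p q : Subset n) → sum (λ j → indicator p j ⊗ indicator q j) ≡ + card (p ∩ q)
  sum-indicator []            []            = refl
  sum-indicator (inside  ∷ p) (inside  ∷ q) = cong (1ℤ ⊕_) (sum-indicator p q)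
  sum-indicator (inside  ∷ p) (outside ∷ q) = trans (ℤ.+-identityˡ _) (sum-indicator p q)
  sum-indicator (outside ∷ p) (inside  ∷ q) = trans (ℤ.+-identityˡ _) (sum-indicator p q)
  sum-indicator (outside ∷ p) (outside ∷ q) = trans (ℤ.+-identityˡ _) (sum-indicator p q)

lookup-injective : {p q : Subset n} → (∀ t → lookup p t ≡ lookup q t) → p ≡ q
lookup-injective {p = p} {q} eq = trans (sym (tabulate∘lookup p)) (trans (tabulate-cong eq) (tabulate∘lookup q))

length≤1⇒all-equal : ∀ {A : Set} {xs : List A} {x y} → length xs ≤ 1 → x ∈ xs → y ∈ xs → x ≡ y
length≤1⇒all-equal {xs = _ ∷ []} _ (here p) (here q) = trans p (sym q)
length≤1⇒all-equal {xs = _ ∷ _ ∷ _} (ℕ.s≤s ()) _ _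

unique∧all-equal⇒length≤1 : ∀ {A : Set} {xs : List A} → Unique xs →
  (∀ {x y} → x ∈ xs → y ∈ xs → x ≡ y) → length xs ≤ 1
unique∧all-equal⇒length≤1 {xs = []}         _                _  = ℕ.z≤n
unique∧all-equal⇒length≤1 {xs = _ ∷ []}     _                _  = ℕ.≤-refl
unique∧all-equal⇒length≤1 {xs = _ ∷ _ ∷ _} ((x≢y ∷ _) ∷ _) eq = contradiction (eq (here refl) (there (here refl))) x≢y

module Oddtown (ℓ : ℕ) (pr : Prime ℓ) where
  open Modular ℓ pr

  %≡0⇒ℓ∣ : ∀ x → x % ℓ ≡ 0 → ℓ∣ + x
  %≡0⇒ℓ∣ x eq = ∣ᵤ⇒∣ (ℕ∣.m%n≡0⇒n∣m x ℓ eq)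

  ℓ∣⇒%≡0 : ∀ x → ℓ∣ + x → x % ℓ ≡ 0
  ℓ∣⇒%≡0 x ℓ∣x = ℕ∣.n∣m⇒m%n≡0 x ℓ (∣⇒∣ᵤ ℓ∣x)

  bad? : (A : Family m n) (i j : Fin m) → Dec (j ≢ i × ¬ (card (A i ∩ A j) % ℓ ≡ 0))
  bad? A i j = ¬? (j Fin.≟ i) ×-dec ¬? (card (A i ∩ A j) % ℓ ℕ.≟ 0)

  upper-bound : (A : Family m n) → IsDefectOddtown 1 ℓ A → m ≤ n ⊔ (2 * n ∸ 4)
  upper-bound {m} {n} A (A-injective , A-notDiv , A-defect) = bound
    where
    v : Fin m → Vector ℤ n
    v i = indicator (A i)

    ℓ∤gram⇒ : ∀ i j → ¬ ℓ∣ dot (v i) (v j) → ¬ (card (A i ∩ A j) % ℓ ≡ 0)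
    ℓ∤gram⇒ i j ℓ∤g = ℓ∤g ∘ subst ℓ∣_ (sym (dot-indicator (A i) (A j))) ∘ %≡0⇒ℓ∣ _

    diagonal : ∀ i → ¬ ℓ∣ dot (v i) (v i)
    diagonal i ℓ∣g = A-notDiv i (ℓ∣⇒%≡0 _ (subst ℓ∣_
      (trans (dot-indicator (A i) (A i)) (cong (λ p → + card p) (Subset.∩-idem (A i)))) ℓ∣g))

    partner∈ : ∀ {i j} → j ≢ i → ¬ ℓ∣ dot (v i) (v j) → j ∈ badPartners ℓ A i
    partner∈ {i} {j} j≢i ℓ∤g = ∈-filter⁺ (bad? A i) (∈-allFin j) (j≢i , ℓ∤gram⇒ i j ℓ∤g)

    unique : ∀ {i j k} → j ≢ i → k ≢ i → ¬ ℓ∣ dot (v i) (v j) → ¬ ℓ∣ dot (v i) (v k) → j ≡ k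
    unique {i} j≢i k≢i ℓ∤gj ℓ∤gk = length≤1⇒all-equal (A-defect i) (partner∈ j≢i ℓ∤gj) (partner∈ k≢i ℓ∤gk)

    independent : ∀ {i j} p q → i ≢ j → ¬ ℓ∣ p → ¬ ℓ∣ q → ∃[ t ] ¬ ℓ∣ lincomb p (v i) q (v j) t
    independent {i} {j} p q i≢j ℓ∤p ℓ∤q =
      -- At an element of exactly one of the two sets the combination takes the value `p` or `q`.
      let t , differ = Fin.¬∀⟶∃¬ n _ (λ t → lookup (A i) t Bool.≟ lookup (A j) t)
                         (i≢j ∘ A-injective ∘ lookup-injective)
      in t , nonzero (lookup (A i) t) (lookup (A j) t) differ
      where
      left : ∀ p q → p ⊗ 1ℤ ⊕ q ⊗ 0ℤ ≡ p
      left = solve-∀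
      right : ∀ p q → p ⊗ 0ℤ ⊕ q ⊗ 1ℤ ≡ q
      right = solve-∀
      nonzero : ∀ a b → a ≢ b → ¬ ℓ∣ (p ⊗ bit a ⊕ q ⊗ bit b)
      nonzero true  true  a≢b = contradiction refl a≢b
      nonzero false false a≢b = contradiction refl a≢b
      nonzero true  false _   = ℓ∤p ∘ subst ℓ∣_ (left p q)
      nonzero false true  _   = ℓ∤q ∘ subst ℓ∣_ (right p q)

    open UpperBound ℓ pr
    open Matched v diagonal unique independent

  -- Sets from different pairs meet in a multiple of `ℓ`, so the only possible bad partner of a set
  -- is the other member of its pair. The map `index` enumerates the pairs by a single finite type.
  paired⇒oddtown : (F : Fin k × Fin 2 → Subset n) →
    (∀ x → ¬ ℓ∣ + card (F x ∩ F x)) →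
    (∀ x y → proj₁ x ≢ proj₁ y → ℓ∣ + card (F x ∩ F y)) →
    (∀ i → F (i , zero) ≢ F (i , suc zero)) →
    (index : Fin m → Fin k × Fin 2) → (∀ {a b} → index a ≡ index b → a ≡ b) →
    IsDefectOddtown 1 ℓ (F ∘ index)
  paired⇒oddtown {k} F diagonal off pair-distinct index index-injective =
      (λ {a} {b} → index-injective ∘ F-injective (index a) (index b))
    , (λ a eq → diagonal (index a) (subst (λ p → ℓ∣ + card p) (sym (Subset.∩-idem (F (index a)))) (%≡0⇒ℓ∣ _ eq)))
    , λ a → unique∧all-equal⇒length≤1 (filter⁺ (bad? A a) (allFin⁺ _)) λ p q →
        same-partner a (proj₂ (∈-filter⁻ (bad? A a) {xs = allFin _} p)) (proj₂ (∈-filter⁻ (bad? A a) {xs = allFin _} q))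
    where
    A = F ∘ index

    F-injective : ∀ x y → F x ≡ F y → x ≡ y
    F-injective x y eq with proj₁ x Fin.≟ proj₁ y
    -- Equal sets from different pairs would have size divisible by `ℓ`.
    F-injective x y eq | no ≢ = contradiction (subst (λ p → ℓ∣ + card (F x ∩ p)) (sym eq) (off x y ≢)) (diagonal x)
    F-injective (i , zero)     (i , zero)     eq | yes refl = refl
    F-injective (i , zero)     (i , suc zero) eq | yes refl = contradiction eq (pair-distinct i)
    F-injective (i , suc zero) (i , zero)     eq | yes refl = contradiction (sym eq) (pair-distinct i)
    F-injective (i , suc zero) (i , suc zero) eq | yes refl = refl

    Bad : Fin _ → Fin _ → Set
    Bad a b = b ≢ a × ¬ (card (A a ∩ A b) % ℓ ≡ 0)

    bad⇒same-pair : ∀ a b → Bad a b → proj₁ (index a) ≡ proj₁ (index b)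
    bad⇒same-pair a b (_ , ≢0) = decidable-stable (_ Fin.≟ _) λ ≢ → ≢0 (ℓ∣⇒%≡0 _ (off (index a) (index b) ≢))

    two-others-equal : (s t u : Fin 2) → t ≢ s → u ≢ s → t ≡ u
    two-others-equal zero       zero       _          t≢s _   = contradiction refl t≢s
    two-others-equal zero       (suc zero) zero       _   u≢s = contradiction refl u≢s
    two-others-equal zero       (suc zero) (suc zero) _   _   = refl
    two-others-equal (suc zero) (suc zero) _          t≢s _   = contradiction refl t≢s
    two-others-equal (suc zero) zero       (suc zero) _   u≢s = contradiction refl u≢s
    two-others-equal (suc zero) zero       zero       _   _   = refl

    same-partner : ∀ a {b c} → Bad a b → Bad a c → b ≡ c
    same-partner a {b} {c} ab ac = index-injective (cong₂ _,_ (trans (sym pb) pc)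
      (two-others-equal (proj₂ (index a)) (proj₂ (index b)) (proj₂ (index c))
        (λ eq → proj₁ ab (index-injective (cong₂ _,_ (sym pb) eq)))
        (λ eq → proj₁ ac (index-injective (cong₂ _,_ (sym pc) eq)))))
      where
      pb = bad⇒same-pair a b ab
      pc = bad⇒same-pair a c ac

  -- On 2 + k points the extremal size 2(2 + k) - 4 is 2k, exactly the number of members of `k`
  -- pairs.
  paired-family : (F : Fin k × Fin 2 → Subset (2 + k)) →
    (∀ x → ¬ ℓ∣ + card (F x ∩ F x)) →
    (∀ x y → proj₁ x ≢ proj₁ y → ℓ∣ + card (F x ∩ F y)) →
    (∀ i → F (i , zero) ≢ F (i , suc zero)) →
    Σ (Family (2 * (2 + k) ∸ 4) (2 + k)) λ A → IsDefectOddtown 1 ℓ A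
  paired-family {k} F diagonal off pair-distinct =
    F ∘ index , paired⇒oddtown F diagonal off pair-distinct index index-injective
    where
    size : 2 * (2 + k) ∸ 4 ≡ k * 2
    size = trans (cong (_∸ 4) (trans (ℕ.*-comm 2 (2 + k)) refl)) (ℕ.m+n∸m≡n 4 (k * 2))
    index : Fin (2 * (2 + k) ∸ 4) → Fin k × Fin 2
    index a = Fin.remQuot 2 (Fin.cast size a)
    index-injective : ∀ {a b} → index a ≡ index b → a ≡ b
    index-injective {a} {b} eq = Fin.toℕ-injective (trans (sym (Fin.toℕ-cast size a)) (trans (cong toℕ
      (trans (sym (Fin.combine-remQuot {k} 2 (Fin.cast size a)))
        (trans (cong (λ (i , s) → Fin.combine i s) eq) (Fin.combine-remQuot {k} 2 (Fin.cast size b)))))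
      (Fin.toℕ-cast size b)))

-- Orthogonal designs

2ℤ -2ℤ : ℤ
2ℤ  = + 2
-2ℤ = - 2ℤ

IsSign : ℤ → Set
IsSign x = x ≡ 1ℤ ⊎ x ≡ -1ℤ

sign-* : ∀ {x y} → IsSign x → IsSign y → IsSign (x ⊗ y)
sign-* (inj₁ refl) (inj₁ refl) = inj₁ refl
sign-* (inj₁ refl) (inj₂ refl) = inj₂ refl
sign-* (inj₂ refl) (inj₁ refl) = inj₂ refl
sign-* (inj₂ refl) (inj₂ refl) = inj₁ refl

sign-square : ∀ {x} → IsSign x → x ⊗ x ≡ 1ℤ
sign-square (inj₁ refl) = refl
sign-square (inj₂ refl) = refl

Matrix : ℕ → ℕ → Set
Matrix m n = Fin m → Vector ℤ n

infixr 8 _•_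
_•_ : ℤ → Vector ℤ n → Vector ℤ n
(a • x) j = a ⊗ x j

dot-• : ∀ a (x : Vector ℤ n) b y → dot (a • x) (b • y) ≡ a ⊗ b ⊗ dot x y
dot-• a x b y = begin
  dot (a • x) (b • y)                       ≡⟨ dot≡sum (a • x) (b • y) ⟩
  sum (λ j → a ⊗ x j ⊗ (b ⊗ y j))           ≡⟨ sum-cong-≗ (λ j → rearrange a (x j) b (y j)) ⟩
  sum (λ j → a ⊗ b ⊗ (x j ⊗ y j))           ≡⟨ *-distribˡ-sum (a ⊗ b) (λ j → x j ⊗ y j) ⟨
  a ⊗ b ⊗ sum (λ j → x j ⊗ y j)             ≡⟨ cong (a ⊗ b ⊗_) (dot≡sum x y) ⟨
  a ⊗ b ⊗ dot x y                           ∎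
  where
  open ≡-Reasoning
  rearrange : ∀ a x b y → a ⊗ x ⊗ (b ⊗ y) ≡ a ⊗ b ⊗ (x ⊗ y)
  rearrange = solve-∀

dot-•-++ : ∀ a (x : Vector ℤ m) b (y : Vector ℤ n) a′ x′ b′ y′ →
           dot (a • x ++ b • y) (a′ • x′ ++ b′ • y′) ≡ a ⊗ a′ ⊗ dot x x′ ⊕ b ⊗ b′ ⊗ dot y y′
dot-•-++ a x b y a′ x′ b′ y′ =
  trans (dot-++ (a • x) (a′ • x′) (b • y) (b′ • y′)) (cong₂ _⊕_ (dot-• a x a′ x′) (dot-• b y b′ y′))

dot-sign : (x : Vector ℤ n) → (∀ j → IsSign (x j)) → dot x x ≡ + n
dot-sign x sx = trans (dot≡sum x x) (trans (sum-cong-≗ (λ j → sign-square (sx j))) (sum-1 _))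
  where
  sum-1 : ∀ n → sum {n} (λ _ → 1ℤ) ≡ + n
  sum-1 zero    = refl
  sum-1 (suc n) = cong (1ℤ ⊕_) (sum-1 n)

↑-elim : (Q : Fin (m + n) → Set) → (∀ i → Q (i ↑ˡ n)) → (∀ i → Q (m ↑ʳ i)) → ∀ i → Q i
↑-elim {m} Q l r i = subst Q (Fin.join-splitAt m _ i) (by-cases (Fin.splitAt m i))
  where
  by-cases : ∀ s → Q (Fin.join m _ s)
  by-cases (inj₁ i) = l i
  by-cases (inj₂ i) = r i

-- The condition X Pᵀ = P Xᵀ, known as amicability in the theory of orthogonal designs.
Amicable : Matrix r n → Matrix r n → Set
Amicable X P = ∀ i j → dot (X i) (P j) ≡ dot (P i) (X j)

-- X Yᵀ + Y Xᵀ = 2c I.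
Paired : Matrix r n → Matrix r n → ℤ → Set
Paired X Y c = (∀ i → dot (X i) (Y i) ≡ c) × (∀ i j → i ≢ j → dot (X i) (Y j) ⊕ dot (Y i) (X j) ≡ 0ℤ)

-- Scalars are kept apart from the blocks, so that Gram entries become scalar combinations of
-- products of rows of the blocks, ready for ring identities.
record Blocks (r : ℕ) : Set where
  field
    a b c d : ℤ
    A B C D : Matrix r r

-- [[aA, bB], [cC, dD]]
⟦_⟧ : Blocks r → Matrix (r + r) (r + r)
⟦ M ⟧ = (λ i → a • A i ++ b • B i) ++ (λ i → c • C i ++ d • D i)
  where open Blocks M

module _ (M : Blocks r) where
  open Blocks M

  block-top : ∀ i → ⟦ M ⟧ (i ↑ˡ r) ≡ a • A i ++ b • B i
  block-top = lookup-++ˡ (λ i → a • A i ++ b • B i) (λ i → c • C i ++ d • D i)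

  block-bottom : ∀ i → ⟦ M ⟧ (r ↑ʳ i) ≡ c • C i ++ d • D i
  block-bottom = lookup-++ʳ (λ i → a • A i ++ b • B i) (λ i → c • C i ++ d • D i)

module _ (M N : Blocks r) where
  private
    module M = Blocks M
    module N = Blocks N

  -- An entrywise relation can be checked block by block. A predicate on one matrix is the case in
  -- which `Q` ignores its second argument.
  block-entries : (Q : ℤ → ℤ → Set) →
    (∀ i j → Q (M.a ⊗ M.A i j) (N.a ⊗ N.A i j)) → (∀ i j → Q (M.b ⊗ M.B i j) (N.b ⊗ N.B i j)) →
    (∀ i j → Q (M.c ⊗ M.C i j) (N.c ⊗ N.C i j)) → (∀ i j → Q (M.d ⊗ M.D i j) (N.d ⊗ N.D i j)) →
    ∀ i j → Q (⟦ M ⟧ i j) (⟦ N ⟧ i j)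
  block-entries Q qa qb qc qd = ↑-elim _
      (λ i → subst₂ (λ u v → ∀ j → Q (u j) (v j)) (sym (block-top M i)) (sym (block-top N i))
        (row (M.a • M.A i) (N.a • N.A i) (M.b • M.B i) (N.b • N.B i) (qa i) (qb i)))
      (λ i → subst₂ (λ u v → ∀ j → Q (u j) (v j)) (sym (block-bottom M i)) (sym (block-bottom N i))
        (row (M.c • M.C i) (N.c • N.C i) (M.d • M.D i) (N.d • N.D i) (qc i) (qd i)))
    where
    row : (x y : Vector ℤ r) (x′ y′ : Vector ℤ r) → (∀ j → Q (x j) (y j)) → (∀ j → Q (x′ j) (y′ j)) →
          ∀ j → Q ((x ++ x′) j) ((y ++ y′) j)
    row x y x′ y′ q q′ = ↑-elim _
      (λ j → subst₂ Q (sym (lookup-++ˡ x x′ j)) (sym (lookup-++ˡ y y′ j)) (q j))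
      (λ j → subst₂ Q (sym (lookup-++ʳ x x′ j)) (sym (lookup-++ʳ y y′ j)) (q′ j))

  -- In these names `t` and `b` stand for the top and bottom halves of the rows.
  gram-tt : ∀ i j → dot (⟦ M ⟧ (i ↑ˡ r)) (⟦ N ⟧ (j ↑ˡ r)) ≡
            M.a ⊗ N.a ⊗ dot (M.A i) (N.A j) ⊕ M.b ⊗ N.b ⊗ dot (M.B i) (N.B j)
  gram-tt i j = trans (cong₂ dot (block-top M i) (block-top N j))
    (dot-•-++ M.a (M.A i) M.b (M.B i) N.a (N.A j) N.b (N.B j))

  gram-tb : ∀ i j → dot (⟦ M ⟧ (i ↑ˡ r)) (⟦ N ⟧ (r ↑ʳ j)) ≡
            M.a ⊗ N.c ⊗ dot (M.A i) (N.C j) ⊕ M.b ⊗ N.d ⊗ dot (M.B i) (N.D j)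
  gram-tb i j = trans (cong₂ dot (block-top M i) (block-bottom N j))
    (dot-•-++ M.a (M.A i) M.b (M.B i) N.c (N.C j) N.d (N.D j))

  gram-bt : ∀ i j → dot (⟦ M ⟧ (r ↑ʳ i)) (⟦ N ⟧ (j ↑ˡ r)) ≡
            M.c ⊗ N.a ⊗ dot (M.C i) (N.A j) ⊕ M.d ⊗ N.b ⊗ dot (M.D i) (N.B j)
  gram-bt i j = trans (cong₂ dot (block-bottom M i) (block-top N j))
    (dot-•-++ M.c (M.C i) M.d (M.D i) N.a (N.A j) N.b (N.B j))

  gram-bb : ∀ i j → dot (⟦ M ⟧ (r ↑ʳ i)) (⟦ N ⟧ (r ↑ʳ j)) ≡
            M.c ⊗ N.c ⊗ dot (M.C i) (N.C j) ⊕ M.d ⊗ N.d ⊗ dot (M.D i) (N.D j)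
  gram-bb i j = trans (cong₂ dot (block-bottom M i) (block-bottom N j))
    (dot-•-++ M.c (M.C i) M.d (M.D i) N.c (N.C j) N.d (N.D j))

-- One step from order r to order 2r. The auxiliary matrix `P` fills the new blocks of every
-- `extend X x`, and `double` takes over its role in the doubled order.
module Doubling {r} (P : Matrix r r) where

  extend : Matrix r r → ℤ → Blocks r
  extend X x = record { a = 1ℤ ; A = X ; b = x ; B = P ; c = x ; C = P ; d = -1ℤ ; D = X }

  double : Blocks r
  double = record { a = 1ℤ ; A = P ; b = 1ℤ ; B = P ; c = -1ℤ ; C = P ; d = 1ℤ ; D = P }

  -- The -1 in the lower left block of `double` fits the -1 before `X` in `extend`: in each quadrant
  -- the terms in `P Pᵀ` agree on both sides, and the rest is the amicability of `X` and `P`.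
  extend-amicable : ∀ X x → Amicable X P → Amicable ⟦ extend X x ⟧ ⟦ double ⟧
  extend-amicable X x XP = ↑-elim _
      (λ i → ↑-elim _
        (λ j → trans (gram-tt X′ double i j) (trans (tt (g i j) (XP i j)) (sym (gram-tt double X′ i j))))
        (λ j → trans (gram-tb X′ double i j) (trans (tb (g i j) (XP i j)) (sym (gram-tb double X′ i j)))))
      (λ i → ↑-elim _
        (λ j → trans (gram-bt X′ double i j) (trans (bt (g i j) (XP i j)) (sym (gram-bt double X′ i j))))
        (λ j → trans (gram-bb X′ double i j) (trans (bb (g i j) (XP i j)) (sym (gram-bb double X′ i j)))))
    where
    X′ = extend X x
    g : Fin r → Fin r → ℤ
    g i j = dot (P i) (P j)
    tt : ∀ p {u v} → u ≡ v → 1ℤ ⊗ 1ℤ ⊗ u ⊕ x ⊗ 1ℤ ⊗ p ≡ 1ℤ ⊗ 1ℤ ⊗ v ⊕ 1ℤ ⊗ x ⊗ p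
    tt p {u} refl = identity x u p
      where
      identity : ∀ x u p → 1ℤ ⊗ 1ℤ ⊗ u ⊕ x ⊗ 1ℤ ⊗ p ≡ 1ℤ ⊗ 1ℤ ⊗ u ⊕ 1ℤ ⊗ x ⊗ p
      identity = solve-∀
    tb : ∀ p {u v} → u ≡ v → 1ℤ ⊗ -1ℤ ⊗ u ⊕ x ⊗ 1ℤ ⊗ p ≡ 1ℤ ⊗ x ⊗ p ⊕ 1ℤ ⊗ -1ℤ ⊗ v
    tb p {u} refl = identity x u p
      where
      identity : ∀ x u p → 1ℤ ⊗ -1ℤ ⊗ u ⊕ x ⊗ 1ℤ ⊗ p ≡ 1ℤ ⊗ x ⊗ p ⊕ 1ℤ ⊗ -1ℤ ⊗ u
      identity = solve-∀
    bt : ∀ p {u v} → u ≡ v → x ⊗ 1ℤ ⊗ p ⊕ -1ℤ ⊗ 1ℤ ⊗ u ≡ -1ℤ ⊗ 1ℤ ⊗ v ⊕ 1ℤ ⊗ x ⊗ p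
    bt p {u} refl = identity x u p
      where
      identity : ∀ x u p → x ⊗ 1ℤ ⊗ p ⊕ -1ℤ ⊗ 1ℤ ⊗ u ≡ -1ℤ ⊗ 1ℤ ⊗ u ⊕ 1ℤ ⊗ x ⊗ p
      identity = solve-∀
    bb : ∀ p {u v} → u ≡ v → x ⊗ -1ℤ ⊗ p ⊕ -1ℤ ⊗ 1ℤ ⊗ u ≡ -1ℤ ⊗ x ⊗ p ⊕ 1ℤ ⊗ -1ℤ ⊗ v
    bb p {u} refl = identity x u p
      where
      identity : ∀ x u p → x ⊗ -1ℤ ⊗ p ⊕ -1ℤ ⊗ 1ℤ ⊗ u ≡ -1ℤ ⊗ x ⊗ p ⊕ 1ℤ ⊗ -1ℤ ⊗ u
      identity = solve-∀

  module _ {p} (PP : Paired P P p) where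

    double-paired : Paired ⟦ double ⟧ ⟦ double ⟧ (p ⊕ p)
    double-paired = ↑-elim _
        (λ i → trans (gram-tt double double i i) (trans (tt (dot (P i) (P i))) (cong (λ z → z ⊕ z) (proj₁ PP i))))
        (λ i → trans (gram-bb double double i i) (trans (bb (dot (P i) (P i))) (cong (λ z → z ⊕ z) (proj₁ PP i))))
      , λ i j i≢j → trans (sym (twice (dot (⟦ double ⟧ i) (⟦ double ⟧ j)))) (cong (2ℤ ⊗_) (orthogonal i j i≢j))
      where
      twice : ∀ z → 2ℤ ⊗ z ≡ z ⊕ z
      twice = solve-∀
      tt : ∀ z → 1ℤ ⊗ 1ℤ ⊗ z ⊕ 1ℤ ⊗ 1ℤ ⊗ z ≡ z ⊕ z
      tt = solve-∀
      bb : ∀ z → -1ℤ ⊗ -1ℤ ⊗ z ⊕ 1ℤ ⊗ 1ℤ ⊗ z ≡ z ⊕ z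
      bb = solve-∀
      tb : ∀ z → 1ℤ ⊗ -1ℤ ⊗ z ⊕ 1ℤ ⊗ 1ℤ ⊗ z ≡ 0ℤ
      tb = solve-∀
      bt : ∀ z → -1ℤ ⊗ 1ℤ ⊗ z ⊕ 1ℤ ⊗ 1ℤ ⊗ z ≡ 0ℤ
      bt = solve-∀
      orthogonal : ∀ i j → i ≢ j → dot (⟦ double ⟧ i) (⟦ double ⟧ j) ≡ 0ℤ
      orthogonal = ↑-elim _
        (λ i → ↑-elim _
          (λ j i≢j → trans (gram-tt double double i j)
            (trans (tt (dot (P i) (P j))) (proj₂ PP i j (i≢j ∘ cong (_↑ˡ r)))))
          (λ j _ → trans (gram-tb double double i j) (tb (dot (P i) (P j)))))
        (λ i → ↑-elim _
          (λ j _ → trans (gram-bt double double i j) (bt (dot (P i) (P j))))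
          (λ j i≢j → trans (gram-bb double double i j)
            (trans (bb (dot (P i) (P j))) (proj₂ PP i j (i≢j ∘ cong (r ↑ʳ_))))))

    -- Within one half the products of `X` with `Y` and of `x • P` with `y • P` add up, which gives
    -- the new constant. Across the halves the mixed terms cancel by amicability with `P`.
    extend-paired : ∀ {c} X x Y y → Paired X Y c → Amicable X P → Amicable Y P →
                    Paired ⟦ extend X x ⟧ ⟦ extend Y y ⟧ (c ⊕ x ⊗ y ⊗ p)
    extend-paired {c} X x Y y XY XP YP = ↑-elim _
        (λ i → trans (gram-tt X′ Y′ i i) (trans (tt x y (XY· i i) (PP· i i)) (diagonal i)))
        (λ i → trans (gram-bb X′ Y′ i i) (trans (bb x y (XY· i i) (PP· i i)) (diagonal i)))
      , ↑-elim _
        (λ i → ↑-elim _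
          (λ j i≢j → trans (cong₂ _⊕_ (trans (gram-tt X′ Y′ i j) (tt x y (XY· i j) (PP· i j)))
                                      (trans (gram-tt Y′ X′ i j) (tt y x (YX· i j) (PP· i j))))
                           (off-diagonal i j (i≢j ∘ cong (_↑ˡ r))))
          (λ j _ → trans (cong₂ _⊕_ (gram-tb X′ Y′ i j) (gram-tb Y′ X′ i j)) (tb (XP i j) (YP i j))))
        (λ i → ↑-elim _
          (λ j _ → trans (cong₂ _⊕_ (gram-bt X′ Y′ i j) (gram-bt Y′ X′ i j)) (bt (XP i j) (YP i j)))
          (λ j i≢j → trans (cong₂ _⊕_ (trans (gram-bb X′ Y′ i j) (bb x y (XY· i j) (PP· i j)))
                                      (trans (gram-bb Y′ X′ i j) (bb y x (YX· i j) (PP· i j))))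
                           (off-diagonal i j (i≢j ∘ cong (r ↑ʳ_)))))
      where
      X′ = extend X x
      Y′ = extend Y y
      XY· YX· PP· : Fin r → Fin r → ℤ
      XY· i j = dot (X i) (Y j)
      YX· i j = dot (Y i) (X j)
      PP· i j = dot (P i) (P j)
      tt : ∀ x y u g → 1ℤ ⊗ 1ℤ ⊗ u ⊕ x ⊗ y ⊗ g ≡ u ⊕ x ⊗ y ⊗ g
      tt = solve-∀
      bb : ∀ x y u g → x ⊗ y ⊗ g ⊕ -1ℤ ⊗ -1ℤ ⊗ u ≡ u ⊕ x ⊗ y ⊗ g
      bb = solve-∀
      diagonal : ∀ i → XY· i i ⊕ x ⊗ y ⊗ PP· i i ≡ c ⊕ x ⊗ y ⊗ p
      diagonal i = cong₂ (λ s t → s ⊕ x ⊗ y ⊗ t) (proj₁ XY i) (proj₁ PP i)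
      off-diagonal : ∀ i j → i ≢ j → XY· i j ⊕ x ⊗ y ⊗ PP· i j ⊕ (YX· i j ⊕ y ⊗ x ⊗ PP· i j) ≡ 0ℤ
      off-diagonal i j i≢j = trans (collect (XY· i j) (YX· i j) x y (PP· i j))
        (trans (cong₂ (λ s t → s ⊕ x ⊗ y ⊗ t) (proj₂ XY i j i≢j) (proj₂ PP i j i≢j)) (vanish x y))
        where
        collect : ∀ u v x y g → u ⊕ x ⊗ y ⊗ g ⊕ (v ⊕ y ⊗ x ⊗ g) ≡ u ⊕ v ⊕ x ⊗ y ⊗ (g ⊕ g)
        collect = solve-∀
        vanish : ∀ x y → 0ℤ ⊕ x ⊗ y ⊗ 0ℤ ≡ 0ℤ
        vanish = solve-∀
      tb : ∀ {u u′ v v′} → u ≡ u′ → v ≡ v′ →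
           1ℤ ⊗ y ⊗ u ⊕ x ⊗ -1ℤ ⊗ v′ ⊕ (1ℤ ⊗ x ⊗ v ⊕ y ⊗ -1ℤ ⊗ u′) ≡ 0ℤ
      tb {u} {v = v} refl refl = cancel x y u v
        where
        cancel : ∀ x y u v → 1ℤ ⊗ y ⊗ u ⊕ x ⊗ -1ℤ ⊗ v ⊕ (1ℤ ⊗ x ⊗ v ⊕ y ⊗ -1ℤ ⊗ u) ≡ 0ℤ
        cancel = solve-∀
      bt : ∀ {u u′ v v′} → u ≡ u′ → v ≡ v′ →
           x ⊗ 1ℤ ⊗ v′ ⊕ -1ℤ ⊗ y ⊗ u ⊕ (y ⊗ 1ℤ ⊗ u′ ⊕ -1ℤ ⊗ x ⊗ v) ≡ 0ℤ
      bt {u} {v = v} refl refl = cancel x y u v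
        where
        cancel : ∀ x y u v → x ⊗ 1ℤ ⊗ v ⊕ -1ℤ ⊗ y ⊗ u ⊕ (y ⊗ 1ℤ ⊗ u ⊕ -1ℤ ⊗ x ⊗ v) ≡ 0ℤ
        cancel = solve-∀

-- An orthogonal design in two variables with weights r ∸ w and w: the sign matrix ε
-- in which δ marks the entries carrying the second variable.
record Design (r w : ℕ) : Set where
  field
    ε δ P   : Matrix r r
    ε-sign  : ∀ i j → IsSign (ε i j)
    -- Together with `ε-sign` this forces each entry of `δ` to be 0 or the corresponding entry of
    -- `ε`.
    εδ-sign : ∀ i j → IsSign (ε i j ⊕ -2ℤ ⊗ δ i j)
    P-sign  : ∀ i j → IsSign (P i j)
    PP      : Paired P P (+ r)
    εε      : Paired ε ε (+ r)
    εδ      : Paired ε δ (+ w)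
    δδ      : Paired δ δ (+ w)
    εP      : Amicable ε P
    δP      : Amicable δ P

trivial-paired : ∀ x y → Paired {1} (λ _ _ → x) (λ _ _ → y) (x ⊗ y)
trivial-paired x y =
    (λ _ → trans (dot≡sum {1} (λ _ → x) (λ _ → y)) (ℤ.+-identityʳ (x ⊗ y)))
  , λ { zero zero 0≢0 → contradiction refl 0≢0 }

trivial-amicable : ∀ x → Amicable {1} {1} (λ _ _ → x) (λ _ _ → 1ℤ)
trivial-amicable x _ _ = dot-comm (λ _ → x) (λ _ → 1ℤ)

-- The two conditions on `d` encode that it is 0 or 1; it selects the variable carried by the single
-- entry.
design-1 : ∀ d → IsSign (1ℤ ⊕ -2ℤ ⊗ + d) → + d ⊗ + d ≡ + d → Design 1 d
design-1 d sign-d d²≡d = record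
  { ε = λ _ _ → 1ℤ ; δ = λ _ _ → + d ; P = λ _ _ → 1ℤ
  ; ε-sign = λ _ _ → inj₁ refl ; εδ-sign = λ _ _ → sign-d ; P-sign = λ _ _ → inj₁ refl
  ; PP = trivial-paired 1ℤ 1ℤ ; εε = trivial-paired 1ℤ 1ℤ
  ; εδ = subst (Paired _ _) (ℤ.*-identityˡ (+ d)) (trivial-paired 1ℤ (+ d))
  ; δδ = subst (Paired _ _) d²≡d (trivial-paired (+ d) (+ d))
  ; εP = trivial-amicable 1ℤ ; δP = trivial-amicable (+ d) }

-- The new blocks carry the first variable if `d` is 0 and the second if `d` is 1. Each row has `r`
-- new entries, so the weight of the second variable grows by 0 or `r`.
design-double : ∀ {r w} d → IsSign (1ℤ ⊕ -2ℤ ⊗ + d) → + d ⊗ + d ≡ + d → Design r w → Design (r + r) (w + d * r)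
design-double {r} {w} d sign-d d²≡d D = record
  { ε = ⟦ extend ε 1ℤ ⟧ ; δ = ⟦ extend δ (+ d) ⟧ ; P = ⟦ double ⟧
  ; ε-sign = block-entries (extend ε 1ℤ) (extend ε 1ℤ) (λ x _ → IsSign x)
      (λ i j → sign-* (inj₁ refl) (ε-sign i j)) (λ i j → sign-* (inj₁ refl) (P-sign i j))
      (λ i j → sign-* (inj₁ refl) (P-sign i j)) (λ i j → sign-* (inj₂ refl) (ε-sign i j))
  ; εδ-sign = block-entries (extend ε 1ℤ) (extend δ (+ d)) (λ x y → IsSign (x ⊕ -2ℤ ⊗ y))
      (λ i j → subst IsSign (scale 1ℤ (ε i j) (δ i j)) (sign-* (inj₁ refl) (εδ-sign i j)))
      (λ i j → subst IsSign (spread (+ d) (P i j)) (sign-* sign-d (P-sign i j)))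
      (λ i j → subst IsSign (spread (+ d) (P i j)) (sign-* sign-d (P-sign i j)))
      (λ i j → subst IsSign (scale -1ℤ (ε i j) (δ i j)) (sign-* (inj₂ refl) (εδ-sign i j)))
  ; P-sign = block-entries double double (λ x _ → IsSign x)
      (λ i j → sign-* (inj₁ refl) (P-sign i j)) (λ i j → sign-* (inj₁ refl) (P-sign i j))
      (λ i j → sign-* (inj₂ refl) (P-sign i j)) (λ i j → sign-* (inj₁ refl) (P-sign i j))
  ; PP = double-paired PP
  ; εε = subst (Paired _ _) (cong (+ r ⊕_) (ℤ.*-identityˡ (+ r))) (extend-paired PP ε 1ℤ ε 1ℤ εε εP εP)
  ; εδ = subst (Paired _ _) (weight (1ℤ ⊗ + d) (ℤ.*-identityˡ (+ d))) (extend-paired PP ε 1ℤ δ (+ d) εδ εP δP)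
  ; δδ = subst (Paired _ _) (weight (+ d ⊗ + d) d²≡d) (extend-paired PP δ (+ d) δ (+ d) δδ δP δP)
  ; εP = extend-amicable ε 1ℤ εP ; δP = extend-amicable δ (+ d) δP }
  where
  open Design D
  open Doubling P
  scale : ∀ s x y → s ⊗ (x ⊕ -2ℤ ⊗ y) ≡ s ⊗ x ⊕ -2ℤ ⊗ (s ⊗ y)
  scale = solve-∀
  spread : ∀ d p → (1ℤ ⊕ -2ℤ ⊗ d) ⊗ p ≡ 1ℤ ⊗ p ⊕ -2ℤ ⊗ (d ⊗ p)
  spread = solve-∀
  weight : ∀ e → e ≡ + d → + w ⊕ e ⊗ + r ≡ + (w + d * r)
  weight e refl = cong (+ w ⊕_) (sym (ℤ.pos-* d r))

designs-1 : ∀ w → w ≤ 1 → Design 1 w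
designs-1 zero          _ = design-1 0 (inj₁ refl) refl
designs-1 (suc zero)    _ = design-1 1 (inj₂ refl) refl
designs-1 (suc (suc _)) (ℕ.s≤s ())

-- A weight up to `r` is inherited with the new blocks in the first variable; a larger one is
-- `w ∸ r` plus the `r` new entries in the second.
designs-double : (∀ w → w ≤ r → Design r w) → ∀ w → w ≤ r + r → Design (r + r) w
designs-double {r} designs w w≤2r with w ℕ.≤? r
... | yes w≤r = subst (Design (r + r)) (ℕ.+-identityʳ w) (design-double 0 (inj₁ refl) refl (designs w w≤r))
... | no  w≰r = subst (Design (r + r)) (trans (cong (w ∸ r ℕ.+_) (ℕ.*-identityˡ r)) (ℕ.m∸n+n≡m (ℕ.≰⇒≥ w≰r)))
  (design-double 1 (inj₂ refl) refl (designs (w ∸ r) (ℕ.≤-trans (ℕ.∸-monoˡ-≤ r w≤2r) (ℕ.≤-reflexive (ℕ.m+n∸n≡m r r)))))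

-- Kronecker products and substitution of matrices into a design

sum-combine : ∀ m (f : Vector ℤ (m * n)) → sum f ≡ sum (λ i → sum (λ j → f (Fin.combine {m} {n} i j)))
sum-combine zero    f = refl
sum-combine {n} (suc m) f = trans (sum-splitAt n f)
  (cong (sum (f ∘ (_↑ˡ m * n)) ⊕_) (sum-combine m (f ∘ (n ↑ʳ_))))

infixr 7 _⊠_
_⊠_ : Vector ℤ m → Vector ℤ n → Vector ℤ (m * n)
_⊠_ {n = n} x y c = let i , j = Fin.remQuot n c in x i ⊗ y j

dot-⊠ : (x x′ : Vector ℤ m) (y y′ : Vector ℤ n) → dot (x ⊠ y) (x′ ⊠ y′) ≡ dot x x′ ⊗ dot y y′
dot-⊠ {m} {n} x x′ y y′ = begin
  dot (x ⊠ y) (x′ ⊠ y′)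
    ≡⟨ dot≡sum (x ⊠ y) (x′ ⊠ y′) ⟩
  sum (λ c → (x ⊠ y) c ⊗ (x′ ⊠ y′) c)
    ≡⟨ sum-combine m (λ c → (x ⊠ y) c ⊗ (x′ ⊠ y′) c) ⟩
  sum (λ i → sum (λ j → (x ⊠ y) (Fin.combine {m} {n} i j) ⊗ (x′ ⊠ y′) (Fin.combine {m} {n} i j)))
    ≡⟨ sum-cong-≗ (λ i → begin
         sum (λ j → (x ⊠ y) (Fin.combine {m} {n} i j) ⊗ (x′ ⊠ y′) (Fin.combine {m} {n} i j))
           ≡⟨ sum-cong-≗ (entry i) ⟩
         sum (λ j → x i ⊗ x′ i ⊗ (y j ⊗ y′ j))
           ≡⟨ *-distribˡ-sum (x i ⊗ x′ i) (λ j → y j ⊗ y′ j) ⟨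
         x i ⊗ x′ i ⊗ sum (λ j → y j ⊗ y′ j)
           ≡⟨ cong (x i ⊗ x′ i ⊗_) (dot≡sum y y′) ⟨
         x i ⊗ x′ i ⊗ dot y y′ ∎) ⟩
  sum (λ i → x i ⊗ x′ i ⊗ dot y y′)
    ≡⟨ *-distribʳ-sum (dot y y′) (λ i → x i ⊗ x′ i) ⟨
  sum (λ i → x i ⊗ x′ i) ⊗ dot y y′
    ≡⟨ cong (_⊗ dot y y′) (dot≡sum x x′) ⟨
  dot x x′ ⊗ dot y y′ ∎
  where
  open ≡-Reasoning
  rearrange : ∀ a b c d → a ⊗ b ⊗ (c ⊗ d) ≡ a ⊗ c ⊗ (b ⊗ d)
  rearrange = solve-∀
  entry : ∀ i j → (x ⊠ y) (Fin.combine {m} {n} i j) ⊗ (x′ ⊠ y′) (Fin.combine {m} {n} i j) ≡ x i ⊗ x′ i ⊗ (y j ⊗ y′ j)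
  entry i j = trans (cong (λ (p , q) → x p ⊗ y q ⊗ (x′ p ⊗ y′ q)) (Fin.remQuot-combine {m} {n} i j))
                    (rearrange (x i) (y j) (x′ i) (y′ j))

𝟙 : Vector ℤ n
𝟙 _ = 1ℤ

unit : Fin n → Vector ℤ n
unit a b = bit (does (a Fin.≟ b))

dot-unit : (a : Fin n) (x : Vector ℤ n) → dot (unit a) x ≡ x a
dot-unit a x = trans (dot≡sum (unit a) x) (sum-unit a x)
  where
  sum-unit : ∀ {n} (a : Fin n) (x : Vector ℤ n) → sum (λ b → unit a b ⊗ x b) ≡ x a
  sum-unit {suc n} zero    x = trans (cong₂ _⊕_ (ℤ.*-identityˡ (x zero)) (sum-replicate-zero n)) (ℤ.+-identityʳ (x zero))
  sum-unit {suc n} (suc a) x = trans (ℤ.+-identityˡ _) (sum-unit a (x ∘ suc))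

unit-off : {a b : Fin n} → a ≢ b → unit a b ≡ 0ℤ
unit-off {a = a} {b} a≢b with a Fin.≟ b
... | yes a≡b = contradiction a≡b a≢b
... | no _    = refl

-- Substitute the v × v matrices J and J - 2I for the two variables of the design.
module Inflation {r w} (D : Design r w) (v : ℕ) where
  open Design D

  -- Where `δ i` vanishes the block is `ε` times a row of J. Elsewhere `δ` equals `ε`, and the block
  -- is `ε` times row `a` of J - 2I.
  row : Fin r × Fin v → Vector ℤ (r * v)
  row (i , a) = lincomb 1ℤ (ε i ⊠ 𝟙) -2ℤ (δ i ⊠ unit a)

  row-sign : ∀ x c → IsSign (row x c)
  row-sign (i , a) c = let j , b = Fin.remQuot v c in entry j (does (a Fin.≟ b))
    where
    on : ∀ x y → x ⊕ -2ℤ ⊗ y ≡ 1ℤ ⊗ (x ⊗ 1ℤ) ⊕ -2ℤ ⊗ (y ⊗ 1ℤ)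
    on = solve-∀
    off : ∀ x y → x ≡ 1ℤ ⊗ (x ⊗ 1ℤ) ⊕ -2ℤ ⊗ (y ⊗ 0ℤ)
    off = solve-∀
    entry : ∀ j u → IsSign (1ℤ ⊗ (ε i j ⊗ 1ℤ) ⊕ -2ℤ ⊗ (δ i j ⊗ bit u))
    entry j true  = subst IsSign (on (ε i j) (δ i j)) (εδ-sign i j)
    entry j false = subst IsSign (off (ε i j) (δ i j)) (ε-sign i j)

  row-gram : ∀ i a j b → dot (row (i , a)) (row (j , b)) ≡
    + v ⊗ dot (ε i) (ε j) ⊕ -2ℤ ⊗ (dot (ε i) (δ j) ⊕ dot (δ i) (ε j)) ⊕ + 4 ⊗ (dot (δ i) (δ j) ⊗ unit b a)
  row-gram i a j b = begin
    dot (row (i , a)) (row (j , b))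
      ≡⟨ dot-lincombˡ 1ℤ (ε i ⊠ 𝟙) -2ℤ (δ i ⊠ unit a) (row (j , b)) ⟩
    1ℤ ⊗ dot (ε i ⊠ 𝟙) (row (j , b)) ⊕ -2ℤ ⊗ dot (δ i ⊠ unit a) (row (j , b))
      ≡⟨ cong₂ (λ s t → 1ℤ ⊗ s ⊕ -2ℤ ⊗ t) (expand (ε i) 𝟙) (expand (δ i) (unit a)) ⟩
    1ℤ ⊗ (1ℤ ⊗ (dot (ε i) (ε j) ⊗ dot 𝟙 𝟙) ⊕ -2ℤ ⊗ (dot (ε i) (δ j) ⊗ dot 𝟙 (unit b)))
      ⊕ -2ℤ ⊗ (1ℤ ⊗ (dot (δ i) (ε j) ⊗ dot (unit a) 𝟙) ⊕ -2ℤ ⊗ (dot (δ i) (δ j) ⊗ dot (unit a) (unit b)))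
      ≡⟨ cong₂ (λ s t → 1ℤ ⊗ (1ℤ ⊗ (dot (ε i) (ε j) ⊗ s) ⊕ -2ℤ ⊗ (dot (ε i) (δ j) ⊗ t))
                         ⊕ -2ℤ ⊗ (1ℤ ⊗ (dot (δ i) (ε j) ⊗ dot (unit a) 𝟙) ⊕ -2ℤ ⊗ (dot (δ i) (δ j) ⊗ dot (unit a) (unit b))))
           (dot-sign {v} 𝟙 (λ _ → inj₁ refl)) (trans (dot-comm 𝟙 (unit b)) (dot-unit b 𝟙)) ⟩
    1ℤ ⊗ (1ℤ ⊗ (dot (ε i) (ε j) ⊗ + v) ⊕ -2ℤ ⊗ (dot (ε i) (δ j) ⊗ 1ℤ))
      ⊕ -2ℤ ⊗ (1ℤ ⊗ (dot (δ i) (ε j) ⊗ dot (unit a) 𝟙) ⊕ -2ℤ ⊗ (dot (δ i) (δ j) ⊗ dot (unit a) (unit b)))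
      ≡⟨ cong₂ (λ s t → 1ℤ ⊗ (1ℤ ⊗ (dot (ε i) (ε j) ⊗ + v) ⊕ -2ℤ ⊗ (dot (ε i) (δ j) ⊗ 1ℤ))
                         ⊕ -2ℤ ⊗ (1ℤ ⊗ (dot (δ i) (ε j) ⊗ s) ⊕ -2ℤ ⊗ (dot (δ i) (δ j) ⊗ t)))
           (dot-unit a 𝟙) (dot-unit a (unit b)) ⟩
    1ℤ ⊗ (1ℤ ⊗ (dot (ε i) (ε j) ⊗ + v) ⊕ -2ℤ ⊗ (dot (ε i) (δ j) ⊗ 1ℤ))
      ⊕ -2ℤ ⊗ (1ℤ ⊗ (dot (δ i) (ε j) ⊗ 1ℤ) ⊕ -2ℤ ⊗ (dot (δ i) (δ j) ⊗ unit b a))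
      ≡⟨ collect (dot (ε i) (ε j)) (+ v) (dot (ε i) (δ j)) (dot (δ i) (ε j)) (dot (δ i) (δ j) ⊗ unit b a) ⟩
    + v ⊗ dot (ε i) (ε j) ⊕ -2ℤ ⊗ (dot (ε i) (δ j) ⊕ dot (δ i) (ε j)) ⊕ + 4 ⊗ (dot (δ i) (δ j) ⊗ unit b a) ∎
    where
    open ≡-Reasoning
    expand : ∀ (x : Vector ℤ r) (y : Vector ℤ v) → dot (x ⊠ y) (row (j , b)) ≡
             1ℤ ⊗ (dot x (ε j) ⊗ dot y 𝟙) ⊕ -2ℤ ⊗ (dot x (δ j) ⊗ dot y (unit b))
    expand x y = trans (dot-lincombʳ 1ℤ (ε j ⊠ 𝟙) -2ℤ (δ j ⊠ unit b) (x ⊠ y))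
      (cong₂ (λ s t → 1ℤ ⊗ s ⊕ -2ℤ ⊗ t) (dot-⊠ x (ε j) y 𝟙) (dot-⊠ x (δ j) y (unit b)))
    collect : ∀ e v f g h → 1ℤ ⊗ (1ℤ ⊗ (e ⊗ v) ⊕ -2ℤ ⊗ (f ⊗ 1ℤ)) ⊕ -2ℤ ⊗ (1ℤ ⊗ (g ⊗ 1ℤ) ⊕ -2ℤ ⊗ h) ≡
                            v ⊗ e ⊕ -2ℤ ⊗ (f ⊕ g) ⊕ + 4 ⊗ h
    collect = solve-∀

  self-paired⇒orthogonal : ∀ {X : Matrix r r} {c} → Paired X X c → ∀ i j → i ≢ j → dot (X i) (X j) ≡ 0ℤ
  self-paired⇒orthogonal {X} XX i j i≢j = ℤ.*-cancelˡ-≡ 2ℤ (dot (X i) (X j)) 0ℤ (trans (twice (dot (X i) (X j))) (proj₂ XX i j i≢j))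
    where
    twice : ∀ z → 2ℤ ⊗ z ≡ z ⊕ z
    twice = solve-∀

  rows-different-block : ∀ i a j b → i ≢ j → dot (row (i , a)) (row (j , b)) ≡ 0ℤ
  rows-different-block i a j b i≢j = trans (row-gram i a j b)
    (zeros (self-paired⇒orthogonal εε i j i≢j) (proj₂ εδ i j i≢j) (self-paired⇒orthogonal δδ i j i≢j))
    where
    vanish : ∀ v u → v ⊗ 0ℤ ⊕ -2ℤ ⊗ 0ℤ ⊕ + 4 ⊗ (0ℤ ⊗ u) ≡ 0ℤ
    vanish = solve-∀
    zeros : ∀ {x y z} → x ≡ 0ℤ → y ≡ 0ℤ → z ≡ 0ℤ → + v ⊗ x ⊕ -2ℤ ⊗ y ⊕ + 4 ⊗ (z ⊗ unit b a) ≡ 0ℤ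
    zeros refl refl refl = vanish (+ v) (unit b a)

  -- These are the only products of distinct rows that may be nonzero over the integers; a suitable
  -- residue of `v` makes their common value divisible by `ℓ`.
  rows-same-block : ∀ i a b → a ≢ b → dot (row (i , a)) (row (i , b)) ≡ + r ⊗ + v ⊖ + 4 ⊗ + w
  rows-same-block i a b a≢b = trans (row-gram i a i b)
    (values (dot (δ i) (δ i)) (proj₁ εε i) (proj₁ εδ i) (trans (dot-comm (δ i) (ε i)) (proj₁ εδ i)) (unit-off (a≢b ∘ sym)))
    where
    evaluate : ∀ v r w z → v ⊗ r ⊕ -2ℤ ⊗ (w ⊕ w) ⊕ + 4 ⊗ (z ⊗ 0ℤ) ≡ r ⊗ v ⊖ + 4 ⊗ w
    evaluate = solve-∀
    values : ∀ {x y y′ u} z → x ≡ + r → y ≡ + w → y′ ≡ + w → u ≡ 0ℤ →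
             + v ⊗ x ⊕ -2ℤ ⊗ (y ⊕ y′) ⊕ + 4 ⊗ (z ⊗ u) ≡ + r ⊗ + v ⊖ + 4 ⊗ + w
    values z refl refl refl refl = evaluate (+ v) (+ r) (+ w) z

-- Extremal families

dot-pointwise : {x y x′ y′ : Vector ℤ n} → (∀ j → x j ⊗ y j ≡ x′ j ⊗ y′ j) → dot x y ≡ dot x′ y′
dot-pointwise {x = x} {y} {x′} {y′} eq = trans (dot≡sum x y) (trans (sum-cong-≗ eq) (sym (dot≡sum x′ y′)))

level : ℤ → Vector ℤ n → Subset n
level a x = tabulate (λ c → does (x c ℤ.≟ a))

twice-level : ∀ {a} {x : Vector ℤ n} → IsSign a → (∀ c → IsSign (x c)) →
              2ℤ • indicator (level a x) ≗ lincomb 1ℤ 𝟙 a x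
twice-level {a = a} {x} a-sign x-sign c =
  trans (cong (λ b → 2ℤ ⊗ bit b) (lookup∘tabulate (λ c → does (x c ℤ.≟ a)) c)) (value (x-sign c) a-sign)
  where
  value : ∀ {a b} → IsSign a → IsSign b → 2ℤ ⊗ bit (does (a ℤ.≟ b)) ≡ 1ℤ ⊗ 1ℤ ⊕ b ⊗ a
  value (inj₁ refl) (inj₁ refl) = refl
  value (inj₁ refl) (inj₂ refl) = refl
  value (inj₂ refl) (inj₁ refl) = refl
  value (inj₂ refl) (inj₂ refl) = refl

dot-𝟙-lincomb : ∀ a (x : Vector ℤ n) b y → dot (lincomb 1ℤ 𝟙 a x) (lincomb 1ℤ 𝟙 b y) ≡
                + n ⊕ (b ⊗ dot y 𝟙 ⊕ a ⊗ dot x 𝟙) ⊕ a ⊗ b ⊗ dot x y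
dot-𝟙-lincomb {n} a x b y = begin
  dot (lincomb 1ℤ 𝟙 a x) z
    ≡⟨ dot-lincombˡ 1ℤ 𝟙 a x z ⟩
  1ℤ ⊗ dot 𝟙 z ⊕ a ⊗ dot x z
    ≡⟨ cong₂ (λ p q → 1ℤ ⊗ p ⊕ a ⊗ q) (dot-lincombʳ 1ℤ 𝟙 b y 𝟙) (dot-lincombʳ 1ℤ 𝟙 b y x) ⟩
  1ℤ ⊗ (1ℤ ⊗ dot 𝟙 𝟙 ⊕ b ⊗ dot 𝟙 y) ⊕ a ⊗ (1ℤ ⊗ dot x 𝟙 ⊕ b ⊗ dot x y)
    ≡⟨ cong₂ (λ p q → 1ℤ ⊗ (1ℤ ⊗ p ⊕ b ⊗ q) ⊕ a ⊗ (1ℤ ⊗ dot x 𝟙 ⊕ b ⊗ dot x y))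
         (dot-sign {n} 𝟙 (λ _ → inj₁ refl)) (dot-comm 𝟙 y) ⟩
  1ℤ ⊗ (1ℤ ⊗ + n ⊕ b ⊗ dot y 𝟙) ⊕ a ⊗ (1ℤ ⊗ dot x 𝟙 ⊕ b ⊗ dot x y)
    ≡⟨ collect (+ n) a b (dot y 𝟙) (dot x 𝟙) (dot x y) ⟩
  + n ⊕ (b ⊗ dot y 𝟙 ⊕ a ⊗ dot x 𝟙) ⊕ a ⊗ b ⊗ dot x y ∎
  where
  open ≡-Reasoning
  z = lincomb 1ℤ 𝟙 b y
  collect : ∀ N s t a b g → 1ℤ ⊗ (1ℤ ⊗ N ⊕ t ⊗ a) ⊕ s ⊗ (1ℤ ⊗ b ⊕ t ⊗ g) ≡ N ⊕ (t ⊗ a ⊕ s ⊗ b) ⊕ s ⊗ t ⊗ g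
  collect = solve-∀

-- The indicator of {x = a} is (1 + a x) / 2; the factor 4 clears the denominators.
card-level : ∀ {a b} {x y : Vector ℤ n} → IsSign a → IsSign b → (∀ c → IsSign (x c)) → (∀ c → IsSign (y c)) →
  + 4 ⊗ + card (level a x ∩ level b y) ≡ + n ⊕ (b ⊗ dot y 𝟙 ⊕ a ⊗ dot x 𝟙) ⊕ a ⊗ b ⊗ dot x y
card-level {a = a} {b} {x} {y} a-sign b-sign x-sign y-sign = begin
  + 4 ⊗ + card (level a x ∩ level b y)                             ≡⟨ cong (+ 4 ⊗_) (dot-indicator (level a x) (level b y)) ⟨
  + 4 ⊗ dot (indicator (level a x)) (indicator (level b y))        ≡⟨ dot-• 2ℤ (indicator (level a x)) 2ℤ (indicator (level b y)) ⟨
  dot (2ℤ • indicator (level a x)) (2ℤ • indicator (level b y))    ≡⟨ dot-cong (twice-level a-sign x-sign) (twice-level b-sign y-sign) ⟩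
  dot (lincomb 1ℤ 𝟙 a x) (lincomb 1ℤ 𝟙 b y)                        ≡⟨ dot-𝟙-lincomb a x b y ⟩
  + _ ⊕ (b ⊗ dot y 𝟙 ⊕ a ⊗ dot x 𝟙) ⊕ a ⊗ b ⊗ dot x y              ∎
  where open ≡-Reasoning

-- The number `h` witnesses that `ℓ` is odd and is an inverse of 2 modulo `ℓ`.
module Odd (ℓ : ℕ) (pr : Prime ℓ) (h : ℕ) (h+h≡1+ℓ : h + h ≡ suc ℓ) where
  open Modular ℓ pr
  open Oddtown ℓ pr

  ℓ∤2 : ¬ ℓ∣ 2ℤ
  ℓ∤2 ℓ∣2 = odd h h+h≡1+ℓ (ℕ.≤-antisym (ℕ∣.∣⇒≤ (∣⇒∣ᵤ ℓ∣2)) 1<ℓ)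
    where
    odd : ∀ h → h + h ≡ suc ℓ → ℓ ≢ 2
    odd zero          ()
    odd (suc zero)    () refl
    odd (suc (suc h)) eq refl with () ← subst (λ z → suc (suc z) ≡ 3) (ℕ.+-comm h (suc (suc h))) eq

  ℓ∤4 : ¬ ℓ∣ + 4
  ℓ∤4 = ℓ∤-* 2ℤ 2ℤ ℓ∤2 ℓ∤2

  σ : Fin 2 → ℤ
  σ zero       = 1ℤ
  σ (suc zero) = -1ℤ

  σ-sign : ∀ s → IsSign (σ s)
  σ-sign zero       = inj₁ refl
  σ-sign (suc zero) = inj₂ refl

  ℓ∣4*⇒∣ : ∀ x → ℓ∣ + 4 ⊗ x → ℓ∣ x
  ℓ∣4*⇒∣ x ℓ∣4x = [ (λ ℓ∣4 → contradiction ℓ∣4 ℓ∤4) , (λ ℓ∣x → ℓ∣x) ]′ (ℓ∣-* (+ 4) x ℓ∣4x)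

  -- The common point ∞ is the head `inside` of each set. It contributes 4 to four times an
  -- intersection size, which cancels against `N` modulo `ℓ`; the row sums vanish too, leaving only
  -- the product of the two sign vectors.
  module Pairs {k N} (x : Fin k → Vector ℤ N) (x-sign : ∀ i c → IsSign (x i c))
    (x⊥𝟙 : ∀ i → ℓ∣ dot (x i) 𝟙) (x⊥x : ∀ i j → i ≢ j → ℓ∣ dot (x i) (x j)) (ℓ∣4+N : ℓ∣ + 4 ⊕ + N) where

    F : Fin k × Fin 2 → Subset (suc N)
    F (i , s) = inside ∷ level (σ s) (x i)

    error : Fin k × Fin 2 → Fin k × Fin 2 → ℤ
    error (i , s) (j , t) = σ t ⊗ dot (x j) 𝟙 ⊕ σ s ⊗ dot (x i) 𝟙

    ℓ∣error : ∀ y z → ℓ∣ error y z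
    ℓ∣error (i , s) (j , t) = ∣m∣n⇒∣m+n (∣n⇒∣m*n (σ t) (x⊥𝟙 j)) (∣n⇒∣m*n (σ s) (x⊥𝟙 i))

    4card : ∀ i s j t → + 4 ⊗ + card (F (i , s) ∩ F (j , t)) ≡
            + 4 ⊕ + N ⊕ error (i , s) (j , t) ⊕ σ s ⊗ σ t ⊗ dot (x i) (x j)
    4card i s j t = trans (distribute (+ card (level (σ s) (x i) ∩ level (σ t) (x j))))
      (trans (cong (+ 4 ⊕_) (card-level (σ-sign s) (σ-sign t) (x-sign i) (x-sign j)))
             (reassociate (+ 4) (+ N) (error (i , s) (j , t)) (σ s ⊗ σ t ⊗ dot (x i) (x j))))
      where
      distribute : ∀ p → + 4 ⊗ (1ℤ ⊕ p) ≡ + 4 ⊕ + 4 ⊗ p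
      distribute = solve-∀
      reassociate : ∀ a b c d → a ⊕ (b ⊕ c ⊕ d) ≡ a ⊕ b ⊕ c ⊕ d
      reassociate = solve-∀

    off : ∀ y z → proj₁ y ≢ proj₁ z → ℓ∣ + card (F y ∩ F z)
    off (i , s) (j , t) i≢j = ℓ∣4*⇒∣ (+ card (F (i , s) ∩ F (j , t))) (subst ℓ∣_ (sym (4card i s j t))
      (∣m∣n⇒∣m+n (∣m∣n⇒∣m+n ℓ∣4+N (ℓ∣error (i , s) (j , t))) (∣n⇒∣m*n (σ s ⊗ σ t) (x⊥x i j i≢j))))

    diagonal : ∀ y → ¬ ℓ∣ + card (F y ∩ F y)
    -- On the diagonal the remaining term is the norm `N`. If `ℓ` divided it, then from 4 + N also
    -- 4.
    diagonal (i , s) ℓ∣card = ℓ∤4 (∣m+n∣n⇒∣m ℓ∣4+N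
      (∣m+n∣m⇒∣n (subst ℓ∣_ (trans (4card i s i s) (cong (+ 4 ⊕ + N ⊕ error (i , s) (i , s) ⊕_) norm)) (∣n⇒∣m*n (+ 4) ℓ∣card))
        (∣m∣n⇒∣m+n ℓ∣4+N (ℓ∣error (i , s) (i , s)))))
      where
      norm : σ s ⊗ σ s ⊗ dot (x i) (x i) ≡ + N
      norm = trans (cong₂ _⊗_ (sign-square (σ-sign s)) (dot-sign (x i) (x-sign i))) (ℤ.*-identityˡ (+ N))

  -- Multiplying the columns by the entries of the first row normalises that row to 𝟙.
  hadamard⇒oddtown : (H : Matrix (suc k) (suc k)) → (∀ i j → IsSign (H i j)) →
    (∀ i j → i ≢ j → ℓ∣ dot (H i) (H j)) → ℓ∣ + 4 ⊕ + suc k →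
    Σ (Family (2 * (2 + k) ∸ 4) (2 + k)) λ A → IsDefectOddtown 1 ℓ A
  hadamard⇒oddtown {k} H H-sign H-off ℓ∣4+N = paired-family F diagonal off pair-distinct
    where
    x : Fin k → Vector ℤ (suc k)
    x i c = H (suc i) c ⊗ H zero c

    x-sign : ∀ i c → IsSign (x i c)
    x-sign i c = sign-* (H-sign (suc i) c) (H-sign zero c)

    x-gram : ∀ i j → dot (x i) (x j) ≡ dot (H (suc i)) (H (suc j))
    x-gram i j = dot-pointwise λ c → trans (rearrange (H (suc i) c) (H zero c) (H (suc j) c))
      (trans (cong (H (suc i) c ⊗ H (suc j) c ⊗_) (sign-square (H-sign zero c))) (ℤ.*-identityʳ (H (suc i) c ⊗ H (suc j) c)))
      where
      rearrange : ∀ a b c → a ⊗ b ⊗ (c ⊗ b) ≡ a ⊗ c ⊗ (b ⊗ b)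
      rearrange = solve-∀

    x⊥𝟙 : ∀ i → ℓ∣ dot (x i) 𝟙
    x⊥𝟙 i = subst ℓ∣_ (dot-pointwise λ c → sym (ℤ.*-identityʳ (x i c))) (H-off (suc i) zero (λ ()))

    x⊥x : ∀ i j → i ≢ j → ℓ∣ dot (x i) (x j)
    x⊥x i j i≢j = subst ℓ∣_ (sym (x-gram i j)) (H-off (suc i) (suc j) (i≢j ∘ Fin.suc-injective))

    open Pairs x x-sign x⊥𝟙 x⊥x ℓ∣4+N

    pair-distinct : ∀ i → F (i , zero) ≢ F (i , suc zero)
    -- Position 0 is the common point, so the comparison is made at position 1, the first column,
    -- where the entry equals exactly one of 1 and -1.
    pair-distinct i eq = clash (x-sign i zero) (cong (λ p → lookup p (suc zero)) eq)
      where
      clash : ∀ {a} → IsSign a → does (a ℤ.≟ 1ℤ) ≢ does (a ℤ.≟ -1ℤ)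
      clash (inj₁ refl) ()
      clash (inj₂ refl) ()

  -- What is needed of the order 2^k: it exceeds `k`, is invertible modulo `ℓ`, and admits designs
  -- of every weight.
  record LargeDesigns (k : ℕ) : Set where
    field
      order inverse : ℕ
      large         : k < order
      inverts       : ℓ∣ + order ⊗ + inverse ⊖ 1ℤ
      designs       : ∀ w → w ≤ order → Design order w

  large-designs : ∀ k → LargeDesigns k
  large-designs zero = record
    { order = 1 ; inverse = 1 ; large = ℕ.≤-refl ; inverts = ℓ∣0 ; designs = designs-1 }
  large-designs (suc k) = record
    { order   = order + order
    ; inverse = inverse * h
    ; large   = ℕ.+-mono-≤ (ℕ.≤-trans (ℕ.s≤s ℕ.z≤n) large) large
    -- With r and s the previous order and inverse, 2h = ℓ + 1 gives (2r)(sh) - 1 = (ℓ + 1)(rs - 1)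
    -- + ℓ.
    ; inverts = subst ℓ∣_ (sym identity) (∣m∣n⇒∣m+n (∣n⇒∣m*n (+ suc ℓ) inverts) ∣-refl)
    ; designs = designs-double designs }
    where
    open LargeDesigns (large-designs k)
    expand : ∀ r s h → (r ⊕ r) ⊗ (s ⊗ h) ⊖ 1ℤ ≡ (h ⊕ h) ⊗ (r ⊗ s ⊖ 1ℤ) ⊕ (h ⊕ h ⊖ 1ℤ)
    expand = solve-∀
    identity : + (order + order) ⊗ + (inverse * h) ⊖ 1ℤ ≡ + suc ℓ ⊗ (+ order ⊗ + inverse ⊖ 1ℤ) ⊕ + ℓ
    identity = trans (cong (λ z → + (order + order) ⊗ z ⊖ 1ℤ) (ℤ.pos-* inverse h))
      (trans (expand (+ order) (+ inverse) (+ h))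
             (cong (λ z → + z ⊗ (+ order ⊗ + inverse ⊖ 1ℤ) ⊕ (+ z ⊖ 1ℤ)) h+h≡1+ℓ))

  -- The order is a separate `N`, so that it can be presented as a successor when a first row is
  -- split off.
  inflated-hadamard : ∀ {r w v} → Design r w → ℓ∣ + r ⊗ + v ⊖ + 4 ⊗ + w → ∀ {N} → r * v ≡ N →
    Σ (Matrix N N) λ H → (∀ i j → IsSign (H i j)) × (∀ i j → i ≢ j → ℓ∣ dot (H i) (H j))
  inflated-hadamard {r} {w} {v} D ℓ∣rv-4w refl =
    (λ p → row (Fin.remQuot v p)) , (λ p → row-sign (Fin.remQuot v p)) , λ p q p≢q →
      orthogonal (Fin.remQuot v p) (Fin.remQuot v q) λ eq →
        p≢q (trans (sym (Fin.combine-remQuot {r} v p))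
          (trans (cong (λ (i , a) → Fin.combine i a) eq) (Fin.combine-remQuot {r} v q)))
    where
    open Inflation D v
    orthogonal : ∀ y z → y ≢ z → ℓ∣ dot (row y) (row z)
    orthogonal (i , a) (j , b) y≢z with i Fin.≟ j
    ... | no  i≢j  = subst ℓ∣_ (sym (rows-different-block i a j b i≢j)) ℓ∣0
    ... | yes refl = subst ℓ∣_ (sym (rows-same-block i a b (y≢z ∘ cong (i ,_)))) ℓ∣rv-4w

  large-oddtown : ∀ N → Σ ℕ λ n → N ≤ n × Σ (Family (2 * n ∸ 4) n) λ A → IsDefectOddtown 1 ℓ A
  large-oddtown N = 2 + size , N≤n , hadamard⇒oddtown H H-sign H-off ℓ∣4+rv
    where
    -- An order above `ℓ` leaves room for the weight ℓ - 1.
    open LargeDesigns (large-designs ℓ)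
    w v : ℕ
    w = ℕ.pred ℓ
    -- The first summand gives rv ≡ 4w modulo `ℓ`; the second makes `v` exceed `N` without changing
    -- its residue.
    v = inverse * (4 * w) + suc N * ℓ
    1+w≡ℓ : suc w ≡ ℓ
    1+w≡ℓ = ℕ.suc-pred ℓ
    v-mod : + v ≡ + inverse ⊗ (+ 4 ⊗ + w) ⊕ + suc N ⊗ + ℓ
    v-mod = cong₂ _⊕_ (trans (ℤ.pos-* inverse (4 * w)) (cong (+ inverse ⊗_) (ℤ.pos-* 4 w))) (ℤ.pos-* (suc N) ℓ)
    expand : ∀ r s w n l → r ⊗ (s ⊗ (+ 4 ⊗ w) ⊕ n ⊗ l) ⊖ + 4 ⊗ w ≡ + 4 ⊗ w ⊗ (r ⊗ s ⊖ 1ℤ) ⊕ r ⊗ n ⊗ l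
    expand = solve-∀
    ℓ∣rv-4w : ℓ∣ + order ⊗ + v ⊖ + 4 ⊗ + w
    ℓ∣rv-4w = subst ℓ∣_ (sym (trans (cong (λ z → + order ⊗ z ⊖ + 4 ⊗ + w) v-mod)
        (expand (+ order) (+ inverse) (+ w) (+ suc N) (+ ℓ))))
      (∣m∣n⇒∣m+n (∣n⇒∣m*n (+ 4 ⊗ + w) inverts) (∣n⇒∣m*n (+ order ⊗ + suc N) ∣-refl))
    v≤rv : v ≤ order * v
    v≤rv = ℕ.m≤n*m v order {{ℕ.>-nonZero (ℕ.≤-trans (ℕ.s≤s ℕ.z≤n) large)}}
    1+N≤v : suc N ≤ v
    1+N≤v = ℕ.≤-trans (ℕ.m≤m*n (suc N) ℓ) (ℕ.m≤n+m (suc N * ℓ) (inverse * (4 * w)))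
    size : ℕ
    size = ℕ.pred (order * v)
    rv≡1+size : order * v ≡ suc size
    rv≡1+size = sym (ℕ.suc-pred (order * v) {{ℕ.>-nonZero (ℕ.≤-trans (ℕ.s≤s ℕ.z≤n) (ℕ.≤-trans 1+N≤v v≤rv))}})
    N≤n : N ≤ 2 + size
    N≤n = ℕ.≤-trans (ℕ.n≤1+n N) (ℕ.≤-trans (ℕ.≤-trans 1+N≤v v≤rv) (ℕ.≤-trans (ℕ.≤-reflexive rv≡1+size) (ℕ.n≤1+n (suc size))))
    hadamard = inflated-hadamard (designs w (ℕ.≤-trans ℕ.pred[n]≤n (ℕ.<⇒≤ large))) ℓ∣rv-4w rv≡1+size
    H = proj₁ hadamard
    H-sign = proj₁ (proj₂ hadamard)
    H-off = proj₂ (proj₂ hadamard)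
    regroup : ∀ w rv → + 4 ⊕ rv ≡ + 4 ⊗ (1ℤ ⊕ w) ⊕ (rv ⊖ + 4 ⊗ w)
    regroup = solve-∀
    -- Since w ≡ -1, the congruence rv ≡ 4w reads rv ≡ -4.
    ℓ∣4+rv : ℓ∣ + 4 ⊕ + suc size
    ℓ∣4+rv = subst ℓ∣_ (trans (sym (regroup (+ w) (+ order ⊗ + v)))
      (cong (+ 4 ⊕_) (trans (sym (ℤ.pos-* order v)) (cong +_ rv≡1+size))))
      (∣m∣n⇒∣m+n (∣n⇒∣m*n (+ 4) (∣-reflexive (cong +_ (sym 1+w≡ℓ)))) ℓ∣rv-4w)

-- The case ℓ = 2 and the division by parity

⁅⁆-disjoint : {i j : Fin n} → i ≢ j → card (⁅ i ⁆ ∩ ⁅ j ⁆) ≡ 0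
⁅⁆-disjoint {n} {i} {j} i≢j = trans (cong card (Subset.Empty-unique λ (x , x∈) →
  i≢j (trans (sym (Subset.x∈⁅y⁆⇒x≡y i (Subset.p∩q⊆p ⁅ i ⁆ ⁅ j ⁆ x∈)))
             (Subset.x∈⁅y⁆⇒x≡y j (Subset.p∩q⊆q ⁅ i ⁆ ⁅ j ⁆ x∈))))) (Subset.∣⊥∣≡0 n)

-- The two additional points contribute 0 or 2 to every intersection, so parities are those of
-- intersections of singletons.
even-oddtown : (pr : Prime 2) → ∀ N → Σ ℕ λ n → N ≤ n × Σ (Family (2 * n ∸ 4) n) λ A → IsDefectOddtown 1 2 A
even-oddtown pr N = 2 + N , ℕ.m≤n+m N 2 , paired-family F diagonal off λ i ()
  where
  open Modular 2 pr
  open Oddtown 2 pr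
  F : Fin N × Fin 2 → Subset (2 + N)
  F (i , zero)     = outside ∷ outside ∷ ⁅ i ⁆
  F (i , suc zero) = inside  ∷ inside  ∷ ⁅ i ⁆

  card-diagonal : ∀ i → + card (⁅ i ⁆ ∩ ⁅ i ⁆) ≡ 1ℤ
  card-diagonal i = cong +_ (trans (cong card (Subset.∩-idem ⁅ i ⁆)) (Subset.∣⁅x⁆∣≡1 i))

  ℓ∤1 : ¬ ℓ∣ 1ℤ
  ℓ∤1 ℓ∣1 = contradiction (ℕ∣.∣⇒≤ (∣⇒∣ᵤ ℓ∣1)) λ { (ℕ.s≤s ()) }

  diagonal : ∀ y → ¬ ℓ∣ + card (F y ∩ F y)
  diagonal (i , zero)     ℓ∣c = ℓ∤1 (subst ℓ∣_ (card-diagonal i) ℓ∣c)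
  diagonal (i , suc zero) ℓ∣c = ℓ∤1 (∣m+n∣m⇒∣n {m = + 2} (subst (λ z → ℓ∣ 1ℤ ⊕ (1ℤ ⊕ z)) (card-diagonal i) ℓ∣c) ∣-refl)

  off : ∀ y z → proj₁ y ≢ proj₁ z → ℓ∣ + card (F y ∩ F z)
  off (i , zero)     (j , zero)     i≢j = subst (λ c → ℓ∣ + c) (sym (⁅⁆-disjoint i≢j)) ℓ∣0
  off (i , zero)     (j , suc zero) i≢j = subst (λ c → ℓ∣ + c) (sym (⁅⁆-disjoint i≢j)) ℓ∣0
  off (i , suc zero) (j , zero)     i≢j = subst (λ c → ℓ∣ + c) (sym (⁅⁆-disjoint i≢j)) ℓ∣0
  off (i , suc zero) (j , suc zero) i≢j = subst (λ c → ℓ∣ + (2 + c)) (sym (⁅⁆-disjoint i≢j)) ∣-refl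

-- An even prime is divisible by 2 and hence equal to it; otherwise (ℓ + 1)/2 is the witness.
prime-cases : ∀ {ℓ} → Prime ℓ → ℓ ≡ 2 ⊎ ∃[ h ] h + h ≡ suc ℓ
prime-cases {ℓ} pr with halve ℓ
  where
  twice : ∀ h → h + h ≡ h * 2
  twice h = trans (cong (h ℕ.+_) (sym (ℕ.+-identityʳ h))) (ℕ.*-comm 2 h)
  halve : ∀ n → (∃[ h ] n ≡ h * 2) ⊎ ∃[ h ] h + h ≡ suc n
  halve zero    = inj₁ (0 , refl)
  halve (suc n) with halve n
  ... | inj₁ (h , refl) = inj₂ (suc h , trans (cong suc (ℕ.+-suc h h)) (cong (2 ℕ.+_) (twice h)))
  ... | inj₂ (h , eq)   = inj₁ (h , trans (sym eq) (twice h))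
... | inj₂ odd        = inj₂ odd
... | inj₁ (h , even) with prime⇒irreducible pr (ℕ∣.divides h even)
...   | inj₂ 2≡ℓ = inj₁ (sym 2≡ℓ)

theorem1p7 : (ℓ : ℕ) → (pr : Prime ℓ)
    → (∀ (m n : ℕ) (A : Family m n)
    → IsDefectOddtown 1 ℓ {{prime⇒nonZero pr}} A → m ≤ n ⊔ (2 * n ∸ 4))
    × (∀ (N : ℕ) → Σ ℕ λ n → N ≤ n
    × Σ (Family (2 * n ∸ 4) n) λ A → IsDefectOddtown 1 ℓ {{prime⇒nonZero pr}} A)
theorem1p7 ℓ pr = (λ m n → Oddtown.upper-bound ℓ pr) , lower-bound (prime-cases pr)
  where
  lower-bound : ℓ ≡ 2 ⊎ ∃[ h ] h + h ≡ suc ℓ → ∀ N → Σ ℕ λ n → N ≤ n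
    × Σ (Family (2 * n ∸ 4) n) λ A → IsDefectOddtown 1 ℓ {{prime⇒nonZero pr}} A
  lower-bound (inj₁ refl)        = even-oddtown pr
  lower-bound (inj₂ (h , 2h≡1+ℓ)) = Odd.large-oddtown ℓ pr h 2h≡1+ℓ
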